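{- Let $g(n) = \max\{h(T): T \text{ is a tree of order } n \}$. Then $g(n) = \Theta(\log n)$ as $n\to\infty$.
   Context: The game: on a finite graph $G$, an invisible mouse and a team of $r$ cats ($r \ge 0$) play as follows. In round $i=1,2,\dots$ the mouse is at some vertex $v_i$, where $v_1$ is arbitrary and for $i\ge 2$ the vertex $v_i$ must be adjacent to $v_{i-1}$ (the mouse must move at every turn). Then each cat chooses any vertex of $G$ (cats are not constrained to move along edges); the mouse is caught in round $i$ if some cat chooses $v_i$. The cats never see the mouse, so a strategy for $r$ cats is a sequence $C_1,C_2,\dots$ of subsets of $V(G)$, each of size at most $r$, and the mouse evades it indefinitely if there is an infinite sequence of vertices $v_1,v_2,\dots$ with $v_i$ adjacent to $v_{i+1}$ and $v_i\notin C_i$ for all $i\ge 1$. The graph $G$ is an $r$-cat-win if some strategy for $r$ cats cannot be evaded indefinitely (equivalently, for finite $G$: there is a finite sequence $C_1,\dots,C_t$ of sets of size at most $r$ such that every walk $v_1,\dots,v_t$ in $G$ has $v_i\in C_i$ for some $i$); otherwise $G$ is an $r$-mouse-win. $h(G)$ denotes the least integer $r$ such that $G$ is an $r$-cat-win. The order of a tree is its number of vertices. -}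

module Defs where

open import Level using (0ℓ)
open import Data.Nat using (ℕ; suc; _+_; _*_; _≤_; _≥_; _>_; NonZero)
open import Data.Fin using (Fin; zero; toℕ; fromℕ)
open import Data.Fin.Subset using (Subset; _∈_; ∣_∣)
open import Data.Product using (∃-syntax; Σ-syntax; _×_)
open import Function.Definitions using (Injective)
open import Relation.Binary using (Rel; Decidable; Symmetric)
open import Relation.Binary.Construct.Closure.ReflexiveTransitive using (Star)
open import Relation.Binary.PropositionalEquality using (_≡_)
open import Relation.Nullary using (¬_)
open import Relation.Unary using (Pred)

record Graph (n : ℕ) : Set₁ where
  infix 4 _~_ _~?_
  field
    _~_      : Rel (Fin n) 0ℓ
    _~?_     : Decidable _~_
    ~-sym    : Symmetric _~_
    ~-irrefl : ∀ {v} → ¬ (v ~ v)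

module _ {n : ℕ} (G : Graph n) where
  open Graph G

  IsWalk : ∀ {t} → (Fin t → Fin n) → Set
  IsWalk v = ∀ i j → toℕ j ≡ suc (toℕ i) → v i ~ v j

  Connected : Set
  Connected = ∀ u v → Star _~_ u v

  record Cycle : Set where
    field
      {k}       : ℕ
      vertex    : Fin (3 + k) → Fin n
      injective : Injective _≡_ _≡_ vertex
      isWalk    : IsWalk vertex
      closes    : vertex (fromℕ (2 + k)) ~ vertex zero

  record IsTree : Set where
    field
      nonEmpty  : NonZero n
      connected : Connected
      acyclic   : ¬ Cycle

  -- Finite form of the game.  It agrees classically with "no infinite walk
  -- evades some infinite sequence of cat moves" by compactness, as G is finite.
  -- The case t = 0 is never a win: the empty walk is not caught.
  CatWin : ℕ → Set
  CatWin r =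
    ∃[ t ] Σ[ C ∈ (Fin t → Subset n) ]
      (∀ i → ∣ C i ∣ ≤ r) ×
      (∀ (v : Fin t → Fin n) → IsWalk v → ∃[ i ] v i ∈ C i)

IsLeast : ∀ {ℓ} → Pred ℕ ℓ → Pred ℕ ℓ
IsLeast P m = P m × (∀ k → P k → m ≤ k)

IsGreatest : ∀ {ℓ} → Pred ℕ ℓ → Pred ℕ ℓ
IsGreatest P m = P m × (∀ k → P k → k ≤ m)

infix 4 h_≈_

-- h(G) = r, as a relation.
h_≈_ : ∀ {n} → Graph n → ℕ → Set
h G ≈ r = IsLeast (CatWin G) r

IsMaxOverTrees : ℕ → ℕ → Set₁
IsMaxOverTrees n = IsGreatest (λ r → Σ[ T ∈ Graph n ] IsTree T × h T ≈ r)

infix 4 _∈Θ_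

-- The lower constant is 1 / a; restricting the positive real constants to the
-- forms 1 / a and b with a, b positive integers loses no generality.
_∈Θ_ : (ℕ → ℕ) → (ℕ → ℕ) → Set
f ∈Θ φ =
  ∃[ a ] ∃[ b ] ∃[ N ] a > 0 × b > 0 ×
    (∀ n → n ≥ N → φ n ≤ a * f n × f n ≤ b * φ n)

{-# OPTIONS --safe #-}
module Submission where

-- Upper bound.  A tree is grown from a root by adding leaves.  Removing the
-- leaves again, one maintains below every remaining vertex p a region together
-- with a way of clearing it.  When a region hanging from v is grafted onto p,
-- the smaller of the two parts is cleared first while one extra cat sits on p;
-- that cat is paid for by the halving of the size, so 1 + ⌊log₂ n⌋ cats suffice.
--
-- Lower bound.  On the binary heap, consider the possible positions S of the
-- mouse in one class of the bipartition, and let Φ be the number of edges that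
-- meet S.  r cats lower Φ by at most 3 r, and a move of the mouse raises it by
-- the number b of edges on the boundary of the union of the positions before
-- and after.  Since that union is made of perfect subtrees, cut along b edges,
-- Φ is then a signed sum of about 2 b powers of two.  The number 1 + 4 + ⋯ +
-- 4 ^ (K - 1) needs K of them, hence Φ cannot fall below it if r is small
-- compared to K.
--
-- The maximum exists constructively because CatWin is a reachability problem
-- on the finite set of subsets, and trees can be listed by adjacency matrix.

open import Defs
open import Data.Nat using (ℕ; _≥_)
open import Data.Nat.Logarithm using (⌊log₂_⌋)
open import Data.Product using (Σ-syntax; _×_)

open import Level using (0ℓ)
open import Data.Bool as Bool using (Bool; true; false; not; _∧_; _xor_; if_then_else_)
import Data.Bool.Properties as Bool
open import Data.Empty as Empty using (⊥-elim)
open import Data.Fin as Fin using (Fin; zero; suc; toℕ; fromℕ; inject₁)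
import Data.Fin.Properties as Fin
open import Data.Fin.Subset using (Subset; _∈_; _∉_; _∪_; ⁅_⁆; ∣_∣; ⊤; ⊥; inside; outside)
open import Data.Fin.Subset.Properties using
  ( _∈?_; anySubset?; Empty-unique; ∈⊤; ∉⊥; ∣p∣≤n; ∣⊥∣≡0; x∈⁅x⁆; p⊆p∪q; q⊆p∪q; ∣⁅x⁆∣≡1; ∪-identityˡ )
open import Data.Integer as ℤ using (ℤ; +_; -[1+_])
import Data.Integer.Properties as ℤ
open import Data.Integer.Tactic.RingSolver using () renaming (solve-∀ to ℤ-solve-∀)
open import Data.List using (List; []; _∷_; _++_; map; tabulate; allFin; length; lookup)
import Data.List.Membership.DecPropositional as DecMembership
open import Data.List.Membership.Propositional using () renaming (_∈_ to _∈ₗ_; _∉_ to _∉ₗ_)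
open import Data.List.Membership.Propositional.Properties using
  (∈-map⁺; ∈-++⁺ˡ; ∈-++⁺ʳ; ∈-allFin; ∈-lookup)
open import Data.List.Relation.Unary.All as All using (All; []; _∷_)
import Data.List.Relation.Unary.All.Properties as All
open import Data.List.Relation.Unary.AllPairs using ([]; _∷_)
open import Data.List.Relation.Unary.Any using (here; there)
open import Data.List.Relation.Unary.Unique.Propositional using (Unique)
import Data.List.Relation.Unary.Unique.Propositional.Properties as Unique
open import Data.Nat using
  (zero; suc; _+_; _*_; _∸_; _^_; _≤_; _<_; _>_; z≤n; s≤s; NonZero; >-nonZero; ⌊_/2⌋)
open import Data.Nat.ListAction using (sum)
open import Data.Nat.Logarithm using (⌊log₂⌋-mono-≤; ⌊log₂[2^n]⌋≡n)
import Data.Nat.Properties as ℕ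
open import Data.Nat.Tactic.RingSolver using (solve-∀)
open import Data.Product using (∃; ∃-syntax; _,_; proj₁; proj₂)
open import Data.Sum using (_⊎_; inj₁; inj₂; [_,_]′)
open import Data.Vec as Vec using (Vec; []; _∷_; here; there)
import Data.Vec.Properties as Vec
open import Function using (_∘_; id; case_of_)
open import Function.Definitions using (Injective)
open import Relation.Binary using (Rel; DecidableEquality) renaming (Decidable to Decidable₂)
open import Relation.Binary.Construct.Closure.ReflexiveTransitive as Star using (Star; ε; _◅_; _◅◅_)
open import Relation.Binary.PropositionalEquality
open import Relation.Nullary using (¬_; Dec; yes; no; does; contradiction)
open import Relation.Nullary.Decidable using (map′; dec-true; _×-dec_; _⊎-dec_; _→-dec_; ¬?)
open import Relation.Unary using (Pred; Decidable)

-- Decidable search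

-- Floyd–Warshall: `Via xs u v` holds if v can be reached from u through
-- intermediate points in xs.
module _ {A : Set} (R : Rel A 0ℓ) where

  Via : List A → Rel A 0ℓ
  Via []       u v = u ≡ v ⊎ R u v
  Via (x ∷ xs) u v = Via xs u v ⊎ (Via xs u x × Via xs x v)

  via-base : ∀ xs {u v} → u ≡ v ⊎ R u v → Via xs u v
  via-base []       p = p
  via-base (x ∷ xs) p = inj₁ (via-base xs p)

  -- If both halves pass through the newest intermediate point, the detour between its first and
  -- last visit is cut out.
  via-trans : ∀ {xs u x v} → x ∈ₗ xs → Via xs u x → Via xs x v → Via xs u v
  via-trans (here refl) p q = inj₂ ([ id , proj₁ ]′ p , [ id , proj₂ ]′ q)
  via-trans (there x∈) (inj₁ p)         (inj₁ q)         = inj₁ (via-trans x∈ p q)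
  via-trans (there x∈) (inj₁ p)         (inj₂ (q₁ , q₂)) = inj₂ (via-trans x∈ p q₁ , q₂)
  via-trans (there x∈) (inj₂ (p₁ , p₂)) (inj₁ q)         = inj₂ (p₁ , via-trans x∈ p₂ q)
  via-trans (there x∈) (inj₂ (p₁ , p₂)) (inj₂ (q₁ , q₂)) = inj₂ (p₁ , q₂)

  via⇒star : ∀ xs {u v} → Via xs u v → Star R u v
  via⇒star []       (inj₁ refl)    = ε
  via⇒star []       (inj₂ r)       = r ◅ ε
  via⇒star (x ∷ xs) (inj₁ p)       = via⇒star xs p
  via⇒star (x ∷ xs) (inj₂ (p , q)) = via⇒star xs p ◅◅ via⇒star xs q

  star⇒via : ∀ {xs} → (∀ x → x ∈ₗ xs) → ∀ {u v} → Star R u v → Via xs u v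
  star⇒via all ε       = via-base _ (inj₁ refl)
  star⇒via all (r ◅ s) = via-trans (all _) (via-base _ (inj₂ r)) (star⇒via all s)

  via? : DecidableEquality A → Decidable₂ R → ∀ xs → Decidable₂ (Via xs)
  via? _≟_ R? []       u v = (u ≟ v) ⊎-dec R? u v
  via? _≟_ R? (x ∷ xs) u v =
    via? _≟_ R? xs u v ⊎-dec (via? _≟_ R? xs u x ×-dec via? _≟_ R? xs x v)

  star? : DecidableEquality A → Decidable₂ R → ∀ xs → (∀ x → x ∈ₗ xs) → Decidable₂ (Star R)
  star? _≟_ R? xs all u v = map′ (via⇒star xs) (star⇒via all) (via? _≟_ R? xs u v)

-- The search over entries is a parameter: vertices are used for cycles, rows of a matrix for
-- graphs.
anyVec? : {A : Set} → (∀ {Q : Pred A 0ℓ} → Decidable Q → Dec (∃ Q)) →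
          ∀ {m} {P : Pred (Vec A m) 0ℓ} → Decidable P → Dec (∃ P)
anyVec? any? {zero}  P? = map′ ([] ,_) (λ { ([] , p) → p }) (P? [])
anyVec? any? {suc m} P? =
  map′ (λ (x , xs , p) → x ∷ xs , p) (λ { (x ∷ xs , p) → x , xs , p })
       (any? λ x → anyVec? any? λ xs → P? (x ∷ xs))

subsets : ∀ n → List (Subset n)
subsets zero    = [] ∷ []
subsets (suc n) = map (inside ∷_) (subsets n) ++ map (outside ∷_) (subsets n)

∈-subsets : ∀ {n} (p : Subset n) → p ∈ₗ subsets n
∈-subsets []            = here refl
∈-subsets (inside  ∷ p) = ∈-++⁺ˡ (∈-map⁺ (inside ∷_) (∈-subsets p))
∈-subsets (outside ∷ p) = ∈-++⁺ʳ (map (inside ∷_) (subsets _)) (∈-map⁺ (outside ∷_) (∈-subsets p))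

_≟ₛ_ : ∀ {n} → DecidableEquality (Subset n)
_≟ₛ_ = Vec.≡-dec Bool._≟_

module _ {n} {P : Pred (Fin n) 0ℓ} (P? : Decidable P) where

  comprehension : Subset n
  comprehension = Vec.tabulate (does ∘ P?)

  ∈-comprehension⁺ : ∀ {v} → P v → v ∈ comprehension
  ∈-comprehension⁺ {v} p = Vec.lookup⇒[]= v comprehension
    (trans (Vec.lookup∘tabulate (does ∘ P?) v) (dec-true (P? v) p))

  ∈-comprehension⁻ : ∀ {v} → v ∈ comprehension → P v
  ∈-comprehension⁻ {v} v∈ with P? v | trans (sym (Vec.lookup∘tabulate (does ∘ P?) v)) (Vec.[]=⇒lookup v∈)
  ... | yes p | _ = p

-- The finite game as a reachability problem

module Game {n} (G : Graph n) where
  open Graph G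

  -- Q is a set of vertices guarded in every round.  After the last round the
  -- mouse moves once more, and w is where it ends.
  Evade : Pred (Fin n) 0ℓ → List (Subset n) → Rel (Fin n) 0ℓ
  Evade Q []       u w = u ≡ w
  Evade Q (C ∷ Cs) u w = ¬ Q u × u ∉ C × ∃[ v ] u ~ v × Evade Q Cs v w

  Free : Pred (Fin n) 0ℓ
  Free _ = Empty.⊥

  Beats : ℕ → List (Subset n) → Set
  Beats r Cs = All (λ C → ∣ C ∣ ≤ r) Cs × (∀ u w → ¬ Evade Free Cs u w)

  walk : ∀ {t} (C : Fin t → Subset n) {u w} → Evade Free (tabulate C) u w →
         Σ[ v ∈ (Fin (suc t) → Fin n) ] IsWalk G v × v zero ≡ u × (∀ i → v (inject₁ i) ∉ C i)
  walk {zero}  C {u} refl = (λ _ → u) , (λ { zero zero () }) , refl , λ ()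
  walk {suc t} C {u} (_ , u∉ , v , u~v , e) with walk (C ∘ suc) e
  ... | vs , isWalk , refl , free = vs′ , isWalk′ , refl , free′
    where
    vs′ : Fin (2 + t) → Fin n
    vs′ zero    = u
    vs′ (suc i) = vs i
    isWalk′ : IsWalk G vs′
    isWalk′ zero    (suc zero) _  = u~v
    isWalk′ (suc i) (suc j)    eq = isWalk i j (ℕ.suc-injective eq)
    free′ : ∀ i → vs′ (inject₁ i) ∉ C i
    free′ zero    = u∉
    free′ (suc i) = free i

  -- `Evade` ends with a move after the last bag, so the walk has one vertex more than there are
  -- bags; the additional round has no cats.
  padded : (Cs : List (Subset n)) → Fin (suc (length Cs)) → Subset n
  padded []       _       = ⊥
  padded (C ∷ Cs) zero    = C
  padded (C ∷ Cs) (suc i) = padded Cs i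

  caught⊎evades : ∀ Cs (v : Fin (suc (length Cs)) → Fin n) → IsWalk G v →
                  (∃[ i ] v i ∈ padded Cs i) ⊎ (∃[ w ] Evade Free Cs (v zero) w)
  caught⊎evades []       v isWalk = inj₂ (_ , refl)
  caught⊎evades (C ∷ Cs) v isWalk with v zero ∈? C
  ... | yes v∈ = inj₁ (zero , v∈)
  ... | no  v∉ with caught⊎evades Cs (v ∘ suc) (λ i j eq → isWalk (suc i) (suc j) (cong suc eq))
  ...   | inj₁ (i , vi∈) = inj₁ (suc i , vi∈)
  ...   | inj₂ (w , e)   = inj₂ (w , id , v∉ , v (suc zero) , isWalk zero (suc zero) refl , e)

  padded-size : ∀ {r} Cs → All (λ C → ∣ C ∣ ≤ r) Cs → ∀ i → ∣ padded Cs i ∣ ≤ r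
  padded-size []       []       _       = ℕ.≤-trans (ℕ.≤-reflexive (∣⊥∣≡0 n)) z≤n
  padded-size (C ∷ Cs) (p ∷ ps) zero    = p
  padded-size (C ∷ Cs) (p ∷ ps) (suc i) = padded-size Cs ps i

  catWin⇒beats : ∀ {r} → CatWin G r → ∃[ Cs ] Beats r Cs
  catWin⇒beats (t , C , small , wins) = tabulate C , All.tabulate⁺ small , λ u w e →
    let v , isWalk , _ , free = walk C e
        i , vi∈ = wins (v ∘ inject₁) λ i j eq → isWalk (inject₁ i) (inject₁ j)
                    (trans (Fin.toℕ-inject₁ j) (trans eq (cong suc (sym (Fin.toℕ-inject₁ i)))))
    in free i vi∈

  beats⇒catWin : ∀ {r Cs} → Beats r Cs → CatWin G r
  beats⇒catWin {Cs = Cs} (small , wins) =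
    suc (length Cs) , padded Cs , padded-size Cs small , λ v isWalk →
      [ id , (λ (w , e) → ⊥-elim (wins _ w e)) ]′ (caught⊎evades Cs v isWalk)

  Next : Subset n → Subset n → Pred (Fin n) 0ℓ
  Next S C w = ∃[ u ] (u ∈ S × u ∉ C × u ~ w)

  next? : ∀ S C → Decidable (Next S C)
  next? S C w = Fin.any? λ u → (u ∈? S) ×-dec ¬? (u ∈? C) ×-dec (u ~? w)

  step : Subset n → Subset n → Subset n
  step S C = comprehension (next? S C)

  after : Subset n → List (Subset n) → Subset n
  after S []       = S
  after S (C ∷ Cs) = after (step S C) Cs

  after⁺ : ∀ Cs {S u w} → u ∈ S → Evade Free Cs u w → w ∈ after S Cs
  after⁺ []       u∈ refl = u∈
  after⁺ (C ∷ Cs) u∈ (_ , u∉ , v , u~v , e) =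
    after⁺ Cs (∈-comprehension⁺ (next? _ C) (_ , u∈ , u∉ , u~v)) e

  after⁻ : ∀ Cs {S w} → w ∈ after S Cs → ∃[ u ] u ∈ S × Evade Free Cs u w
  after⁻ []       w∈ = _ , w∈ , refl
  after⁻ (C ∷ Cs) {S} w∈ with after⁻ Cs w∈
  ... | v , v∈ , e with ∈-comprehension⁻ (next? S C) v∈
  ...   | u , u∈ , u∉ , u~v = u , u∈ , id , u∉ , v , u~v , e

  Move : ℕ → Rel (Subset n) 0ℓ
  Move r S S′ = ∃[ C ] (∣ C ∣ ≤ r × S′ ≡ step S C)

  star⇒after : ∀ {r S S′} → Star (Move r) S S′ →
               ∃[ Cs ] All (λ C → ∣ C ∣ ≤ r) Cs × S′ ≡ after S Cs
  star⇒after ε = [] , [] , refl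
  star⇒after ((C , c , refl) ◅ ms) =
    let Cs , cs , eq = star⇒after ms in C ∷ Cs , c ∷ cs , eq

  after⇒star : ∀ {r S} Cs → All (λ C → ∣ C ∣ ≤ r) Cs → Star (Move r) S (after S Cs)
  after⇒star []       []       = ε
  after⇒star (C ∷ Cs) (c ∷ cs) = (C , c , refl) ◅ after⇒star Cs cs

  catWin? : Decidable (CatWin G)
  catWin? r = map′ from to
    -- The cats win exactly when the set of possible positions can be driven from `⊤` to `⊥`.
    (star? (Move r) _≟ₛ_ move? (subsets n) ∈-subsets ⊤ ⊥)
    where
    move? : Decidable₂ (Move r)
    move? S S′ = anySubset? λ C → (∣ C ∣ ℕ.≤? r) ×-dec (S′ ≟ₛ step S C)
    from : Star (Move r) ⊤ ⊥ → CatWin G r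
    from ms = let Cs , cs , eq = star⇒after ms in
      beats⇒catWin (cs , λ u w e → ∉⊥ (subst (w ∈_) (sym eq) (after⁺ Cs ∈⊤ e)))
    to : CatWin G r → Star (Move r) ⊤ ⊥
    to win = let Cs , cs , wins = catWin⇒beats win in
      subst (Star (Move r) ⊤)
        (Empty-unique λ (w , w∈) → let u , _ , e = after⁻ Cs w∈ in wins u w e)
        (after⇒star Cs cs)

  catWin-all : CatWin G n
  catWin-all = 1 , (λ _ → ⊤) , (λ _ → ∣p∣≤n {n} ⊤) , λ v _ → zero , ∈⊤

-- Extremal values of decidable predicates

least : ∀ {P : Pred ℕ 0ℓ} → Decidable P → ∀ n → P n → ∃ (IsLeast P)
least {P} P? n pn with P? 0
... | yes p0 = 0 , p0 , λ _ _ → z≤n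
least P? zero pn | no ¬p0 = contradiction pn ¬p0
least {P} P? (suc n) pn | no ¬p0 with least (P? ∘ suc) n pn
... | m , pm , min = suc m , pm , λ { zero p → contradiction p ¬p0 ; (suc k) p → s≤s (min k p) }

greatest : ∀ {P : Pred ℕ 0ℓ} → Decidable P → ∀ b → (∀ k → P k → k ≤ b) → ∃ P → ∃ (IsGreatest P)
greatest P? b bound p with P? b
... | yes pb = b , pb , bound
greatest P? zero bound (k , pk) | no ¬pb with bound k pk
... | z≤n = contradiction pk ¬pb
greatest P? (suc b) bound p | no ¬pb = greatest P? b
  (λ k pk → ℕ.≤-pred (ℕ.≤∧≢⇒< (bound k pk) (λ { refl → ¬pb pk }))) p

isLeast? : ∀ {P : Pred ℕ 0ℓ} → Decidable P → ∀ b → P b → Decidable (IsLeast P)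
isLeast? P? b pb m with least P? b pb
... | k , pk , min = map′ (λ { refl → pk , min })
        (λ (pm , min′) → ℕ.≤-antisym (min′ k pk) (min m pm)) (m ℕ.≟ k)

catNumber : ∀ {n} (G : Graph n) → ∃ (h G ≈_)
catNumber {n} G = least (Game.catWin? G) n (Game.catWin-all G)

h≈? : ∀ {n} (G : Graph n) → Decidable (h G ≈_)
h≈? {n} G = isLeast? (Game.catWin? G) n (Game.catWin-all G)

h≤order : ∀ {n r} (G : Graph n) → h G ≈ r → r ≤ n
h≤order {n} G (_ , min) = min n (Game.catWin-all G)

-- Graphs as adjacency matrices

cycle? : ∀ {n} (G : Graph n) → Dec (Cycle G)
cycle? {n} G = map′ from to
  -- The 3 + k vertices of a cycle are distinct, hence k < n and the search is finite.
  (Fin.any? λ (k : Fin n) → anyVec? Fin.any? λ (vs : Vec (Fin n) (3 + toℕ k)) → isCycle? (Vec.lookup vs))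
  where
  open Graph G
  IsCycle : ∀ {k} → (Fin (3 + k) → Fin n) → Set
  IsCycle {k} v = (∀ i j → v i ≡ v j → i ≡ j) × IsWalk G v × v (fromℕ (2 + k)) ~ v zero
  isCycle? : ∀ {k} (v : Fin (3 + k) → Fin n) → Dec (IsCycle v)
  isCycle? v =
    (Fin.all? λ i → Fin.all? λ j → (v i Fin.≟ v j) →-dec (i Fin.≟ j)) ×-dec
    (Fin.all? λ i → Fin.all? λ j → (toℕ j ℕ.≟ suc (toℕ i)) →-dec (v i ~? v j)) ×-dec
    (v _ ~? v zero)
  from : (∃[ k ] Σ[ vs ∈ Vec (Fin n) (3 + toℕ k) ] IsCycle (Vec.lookup vs)) → Cycle G
  from (k , vs , inj , isWalk , closes) = record
    { vertex = Vec.lookup vs ; injective = inj _ _ ; isWalk = isWalk ; closes = closes }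
  to : Cycle G → ∃[ k ] Σ[ vs ∈ Vec (Fin n) (3 + toℕ k) ] IsCycle (Vec.lookup vs)
  to c = Fin.fromℕ< k<n , subst (λ m → Σ[ vs ∈ Vec (Fin n) (3 + m) ] IsCycle (Vec.lookup vs))
    (sym (Fin.toℕ-fromℕ< k<n))
    ( Vec.tabulate vertex
    , (λ i j eq → injective (trans (sym (look i)) (trans eq (look j))))
    , (λ i j eq → subst₂ _~_ (sym (look i)) (sym (look j)) (isWalk i j eq))
    , subst₂ _~_ (sym (look _)) (sym (look zero)) closes)
    where
    open Cycle c
    look = Vec.lookup∘tabulate vertex
    k<n : k < n
    k<n = ℕ.≤-trans (ℕ.m≤n+m (suc k) 2) (Fin.injective⇒≤ injective)

isTree? : ∀ {n} (G : Graph n) → Dec (IsTree G)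
isTree? {n} G = map′
  (λ (n≢0 , c , a) → record { nonEmpty = n≢0 ; connected = c ; acyclic = a })
  (λ t → IsTree.nonEmpty t , IsTree.connected t , IsTree.acyclic t)
  (ℕ.nonZero? n
   ×-dec (Fin.all? λ u → Fin.all? λ v → star? (Graph._~_ G) Fin._≟_ (Graph._~?_ G) (allFin n) ∈-allFin u v)
   ×-dec ¬? (cycle? G))

-- Symmetrising and ignoring the diagonal makes every matrix a graph, so the search over matrices
-- has no side condition.
fromMatrix : ∀ {n} → Vec (Subset n) n → Graph n
fromMatrix M = record
  { _~_      = λ u v → u ≢ v × (v ∈ Vec.lookup M u ⊎ u ∈ Vec.lookup M v)
  ; _~?_     = λ u v → ¬? (u Fin.≟ v) ×-dec ((v ∈? Vec.lookup M u) ⊎-dec (u ∈? Vec.lookup M v))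
  ; ~-sym    = λ (u≢v , e) → (u≢v ∘ sym) , [ inj₂ , inj₁ ]′ e
  ; ~-irrefl = λ (u≢u , _) → u≢u refl
  }

toMatrix : ∀ {n} → Graph n → Vec (Subset n) n
toMatrix G = Vec.tabulate λ u → comprehension (Graph._~?_ G u)

-- The vertices are the same and adjacency is only logically equivalent: a graph rebuilt from its
-- matrix has other proofs of adjacency.
record _≅_ {n} (G H : Graph n) : Set where
  field
    to   : ∀ {u v} → Graph._~_ G u v → Graph._~_ H u v
    from : ∀ {u v} → Graph._~_ H u v → Graph._~_ G u v

open _≅_

≅-sym : ∀ {n} {G H : Graph n} → G ≅ H → H ≅ G
≅-sym e = record { to = from e ; from = to e }

fromMatrix-toMatrix : ∀ {n} (G : Graph n) → G ≅ fromMatrix (toMatrix G)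
fromMatrix-toMatrix G = record
  { to   = λ {u} {v} u~v → (λ { refl → ~-irrefl u~v }) ,
             inj₁ (subst (v ∈_) (sym (row u)) (∈-comprehension⁺ (u ~?_) u~v))
  ; from = λ (_ , e) → [ adjacent , ~-sym ∘ adjacent ]′ e
  }
  where
  open Graph G
  row : ∀ u → Vec.lookup (toMatrix G) u ≡ comprehension (u ~?_)
  row = Vec.lookup∘tabulate (λ u → comprehension (u ~?_))
  adjacent : ∀ {u v} → v ∈ Vec.lookup (toMatrix G) u → u ~ v
  adjacent {u} v∈ = ∈-comprehension⁻ (u ~?_) (subst (_ ∈_) (row u) v∈)

module _ {n} {G H : Graph n} (e : G ≅ H) where

  ≅-walk : ∀ {t} {v : Fin t → Fin n} → IsWalk G v → IsWalk H v
  ≅-walk isWalk i j eq = to e (isWalk i j eq)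

  ≅-cycle : Cycle G → Cycle H
  ≅-cycle c = record { vertex = vertex ; injective = injective ; isWalk = ≅-walk isWalk
                     ; closes = to e closes }
    where open Cycle c

module _ {n} {G H : Graph n} (e : G ≅ H) where

  ≅-catWin : ∀ {r} → CatWin G r → CatWin H r
  ≅-catWin (t , C , small , wins) = t , C , small , λ v isWalk → wins v (≅-walk (≅-sym e) isWalk)

  ≅-isTree : IsTree G → IsTree H
  ≅-isTree t = record
    { nonEmpty  = nonEmpty
    ; connected = λ u v → Star.map (to e) (connected u v)
    ; acyclic   = acyclic ∘ ≅-cycle (≅-sym e) }
    where open IsTree t

≅-h : ∀ {n r} {G H : Graph n} → G ≅ H → h G ≈ r → h H ≈ r
≅-h e (win , min) = ≅-catWin e win , λ k w → min k (≅-catWin (≅-sym e) w)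

-- The maximum of h over the trees of a given order

TreeWithH : ℕ → ℕ → Set₁
TreeWithH n r = Σ[ T ∈ Graph n ] IsTree T × h T ≈ r

-- Replaces the quantification over all graphs in `TreeWithH` by one over finitely many matrices.
treeWithH? : ∀ n r → Dec (∃[ M ] (IsTree (fromMatrix {n} M) × h fromMatrix M ≈ r))
treeWithH? n r = anyVec? anySubset? λ M → isTree? (fromMatrix M) ×-dec h≈? (fromMatrix M) r

maxOverTrees : ∀ n → Σ[ T ∈ Graph n ] IsTree T → ∃ (IsMaxOverTrees n)
maxOverTrees n (T , isTree) =
  let m , (M , p) , max = greatest (treeWithH? n) n (λ k (M , _ , h) → h≤order (fromMatrix M) h)
                            (_ , toM (T , isTree , proj₂ (catNumber T)))
  in m , (fromMatrix M , p) , λ k t → max k (toM t)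
  where
  toM : ∀ {r} → TreeWithH n r → ∃[ M ] (IsTree (fromMatrix {n} M) × h fromMatrix M ≈ r)
  toM (T , isTree , h) = let e = fromMatrix-toMatrix T in
    toMatrix T , ≅-isTree e isTree , ≅-h e h

-- Logarithmically many cats suffice

∣⁅x⁆∪p∣≤1+∣p∣ : ∀ {n} (x : Fin n) (p : Subset n) → ∣ ⁅ x ⁆ ∪ p ∣ ≤ suc ∣ p ∣
∣⁅x⁆∪p∣≤1+∣p∣ zero    (inside  ∷ p) rewrite ∪-identityˡ p = s≤s (ℕ.n≤1+n _)
∣⁅x⁆∪p∣≤1+∣p∣ zero    (outside ∷ p) rewrite ∪-identityˡ p = ℕ.≤-refl
∣⁅x⁆∪p∣≤1+∣p∣ (suc x) (inside  ∷ p) = s≤s (∣⁅x⁆∪p∣≤1+∣p∣ x p)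
∣⁅x⁆∪p∣≤1+∣p∣ (suc x) (outside ∷ p) = ∣⁅x⁆∪p∣≤1+∣p∣ x p

x≤y⇒x+y<2^1+k⇒x<2^k : ∀ {x y} k → x ≤ y → x + y < 2 ^ suc k → x < 2 ^ k
x≤y⇒x+y<2^1+k⇒x<2^k {x} {y} k x≤y x+y< = ℕ.*-cancelˡ-< 2 x (2 ^ k) (begin-strict
  2 * x       ≡⟨ cong (λ s → x + s) (ℕ.+-identityʳ x) ⟩
  x + x       ≤⟨ ℕ.+-monoʳ-≤ x x≤y ⟩
  x + y       <⟨ x+y< ⟩
  2 ^ suc k   ∎)
  where open ℕ.≤-Reasoning

sum-agree : ∀ {A : Set} {f g : A → ℕ} {L} → All (λ x → f x ≡ g x) L → sum (map f L) ≡ sum (map g L)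
sum-agree []         = refl
sum-agree (eq ∷ eqs) = cong₂ _+_ eq (sum-agree eqs)

-- Used when a leaf is pruned: `c` is the size of its branch, which is added to that of its
-- neighbour `u`, so the total is preserved.
sum-update : ∀ {A : Set} {f g : A → ℕ} {u c L} → Unique L → u ∈ₗ L →
             g u ≡ c + f u → (∀ {x} → x ≢ u → g x ≡ f x) →
             sum (map g L) ≡ c + sum (map f L)
sum-update {f = f} {g} {u} {c} {_ ∷ L} (u∉ ∷ _) (here refl) at-u else = begin
  g u + sum (map g L)        ≡⟨ cong₂ _+_ at-u (sum-agree (All.map (λ u≢x → else (u≢x ∘ sym)) u∉)) ⟩
  c + f u + sum (map f L)    ≡⟨ ℕ.+-assoc c (f u) _ ⟩
  c + (f u + sum (map f L))  ∎
  where open ≡-Reasoning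
sum-update {f = f} {g} {u} {c} {x ∷ L} (x∉ ∷ uniq) (there u∈) at-u else = begin
  g x + sum (map g L)        ≡⟨ cong₂ _+_ (else (All.lookup x∉ u∈)) (sum-update uniq u∈ at-u else) ⟩
  f x + (c + sum (map f L))  ≡⟨ sym (ℕ.+-assoc (f x) c _) ⟩
  f x + c + sum (map f L)    ≡⟨ cong (_+ sum (map f L)) (ℕ.+-comm (f x) c) ⟩
  c + f x + sum (map f L)    ≡⟨ ℕ.+-assoc c (f x) _ ⟩
  c + (f x + sum (map f L))  ∎
  where open ≡-Reasoning

unique⇒lookup-injective : ∀ {A : Set} {L : List A} → Unique L → Injective _≡_ _≡_ (lookup L)
unique⇒lookup-injective {L = _ ∷ L} (x∉ ∷ uniq) {zero}  {zero}  eq = refl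
unique⇒lookup-injective {L = _ ∷ L} (x∉ ∷ uniq) {zero}  {suc j} eq = contradiction eq (All.lookup x∉ (∈-lookup j))
unique⇒lookup-injective {L = _ ∷ L} (x∉ ∷ uniq) {suc i} {zero}  eq = contradiction (sym eq) (All.lookup x∉ (∈-lookup i))
unique⇒lookup-injective {L = _ ∷ L} (x∉ ∷ uniq) {suc i} {suc j} eq = cong suc (unique⇒lookup-injective uniq eq)

module Clearing {n} (G : Graph n) where
  open Graph G
  open Game G

  evade-++ : ∀ {Q} As {Bs u w} → Evade Q (As ++ Bs) u w → ∃[ m ] Evade Q As u m × Evade Q Bs m w
  evade-++ []       e = _ , refl , e
  evade-++ (A ∷ As) (¬q , u∉ , v , u~v , e) =
    let m , e₁ , e₂ = evade-++ As e in m , (¬q , u∉ , v , u~v , e₁) , e₂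

  guard : Fin n → List (Subset n) → List (Subset n)
  guard p = map (⁅ p ⁆ ∪_)

  -- Turns a cat staying on `p` into a restriction on the mouse, so that a branch can be cleared
  -- with `p` among the guarded vertices.
  evade-guard : ∀ {Q p} Bs {u w} → Evade Q (guard p Bs) u w → Evade (λ x → x ≡ p ⊎ Q x) Bs u w
  evade-guard []       e = e
  evade-guard {p = p} (B ∷ Bs) (¬q , u∉ , v , u~v , e) =
    [ (λ { refl → u∉ (p⊆p∪q B (x∈⁅x⁆ p)) }) , ¬q ]′ , u∉ ∘ q⊆p∪q ⁅ p ⁆ B , v , u~v , evade-guard Bs e

  guard-narrow : ∀ {p k Bs} → All (λ B → ∣ B ∣ ≤ k) Bs → All (λ B → ∣ B ∣ ≤ suc k) (guard p Bs)
  guard-narrow []       = []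
  guard-narrow {p} {Bs = B ∷ _} (b ∷ bs) = ℕ.≤-trans (∣⁅x⁆∪p∣≤1+∣p∣ p B) (s≤s b) ∷ guard-narrow bs

  -- A set Region hanging from p, with a way of clearing it together with p.
  -- While Q is guarded, a mouse outside stays in X until it enters Q; so X is
  -- what may still be contaminated, and p is not needed as a guard afterwards.
  record Branch (p : Fin n) : Set₁ where
    field
      Region : Pred (Fin n) 0ℓ
      size   : ℕ
      bags   : List (Subset n)
      closed : ∀ {u w} → Region u → u ~ w → w ≡ p ⊎ Region w
      size>0 : size > 0
      narrow : ∀ k → size < 2 ^ k → All (λ B → ∣ B ∣ ≤ k) bags
      clears : ∀ {Q X : Pred (Fin n) 0ℓ} → (∀ {v w} → X v → ¬ Q v → v ~ w → X w ⊎ Q w) →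
               ∀ {u w} → (X u ⊎ Q u) ⊎ (u ≡ p ⊎ Region u) → Evade Q bags u w → X w ⊎ Q w

  open Branch

  bare : ∀ p → Branch p
  bare p = record
    { Region = λ _ → Empty.⊥
    ; size   = 1
    ; bags   = ⁅ p ⁆ ∷ []
    ; closed = λ ()
    ; size>0 = ℕ.≤-refl
    ; narrow = λ { zero (s≤s ()) ; (suc k) _ → ℕ.≤-trans (ℕ.≤-reflexive (∣⁅x⁆∣≡1 p)) (s≤s z≤n) ∷ [] }
    ; clears = λ where
        outer (inj₁ (inj₁ x))    (¬q , _ , _ , u~v , refl) → outer x ¬q u~v
        outer (inj₁ (inj₂ q))    (¬q , _)                  → contradiction q ¬q
        outer (inj₂ (inj₁ refl)) (_ , u∉ , _)              → contradiction (x∈⁅x⁆ p) u∉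
    }

  module _ {p v} (b : Branch v) (a : Branch p) (nbrs : ∀ {w} → v ~ w → w ≡ p ⊎ Region b w) where

    private
      R : Pred (Fin n) 0ℓ
      R x = (x ≡ v ⊎ Region b x) ⊎ Region a x

      R-closed : ∀ {u w} → R u → u ~ w → w ≡ p ⊎ R w
      R-closed (inj₁ (inj₁ refl)) e = [ inj₁ , inj₂ ∘ inj₁ ∘ inj₂ ]′ (nbrs e)
      R-closed (inj₁ (inj₂ r))    e = inj₂ (inj₁ (closed b r e))
      R-closed (inj₂ r)           e = [ inj₁ , inj₂ ∘ inj₂ ]′ (closed a r e)

      size>0′ : size b + size a > 0
      size>0′ = ℕ.≤-trans (size>0 a) (ℕ.m≤n+m (size a) (size b))

    -- First `b` is cleared with a guard on `p`; meanwhile the region of `a` counts as contaminated.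
    -- What is left is in `X`, `Q`, `p` or the region of `a`, which is exactly where `a` may start,
    -- and clearing `a` takes care of `p` itself.
    graft-light : size b ≤ size a → Branch p
    graft-light b≤a = record
      { Region = R
      ; size   = size b + size a
      ; bags   = guard p (bags b) ++ bags a
      ; closed = R-closed
      ; size>0 = size>0′
      ; narrow = λ where
          zero    s< → contradiction (size>0′) (ℕ.<⇒≱ s<)
          (suc k) s< → All.++⁺ (guard-narrow (narrow b k (x≤y⇒x+y<2^1+k⇒x<2^k k b≤a s<)))
                               (narrow a (suc k) (ℕ.≤-<-trans (ℕ.m≤n+m (size a) (size b)) s<))
      ; clears = λ {Q} {X} → clears′ {Q} {X}
      }
      where
      clears′ : ∀ {Q X : Pred (Fin n) 0ℓ} → (∀ {v w} → X v → ¬ Q v → v ~ w → X w ⊎ Q w) →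
                ∀ {u w} → (X u ⊎ Q u) ⊎ (u ≡ p ⊎ R u) → Evade Q (guard p (bags b) ++ bags a) u w → X w ⊎ Q w
      clears′ {Q} {X} outer {u} {w} start e with evade-++ (guard p (bags b)) e
      ... | m , e₁ , e₂ = clears a outer (middle (clears b {Q′} {X′} outer′ (start′ start) (evade-guard (bags b) e₁))) e₂
        where
        Q′ X′ : Pred (Fin n) 0ℓ
        Q′ x = x ≡ p ⊎ Q x
        X′ x = X x ⊎ Region a x
        outer′ : ∀ {v w} → X′ v → ¬ Q′ v → v ~ w → X′ w ⊎ Q′ w
        outer′ (inj₁ x) ¬q e = [ inj₁ ∘ inj₁ , inj₂ ∘ inj₂ ]′ (outer x (¬q ∘ inj₂) e)
        outer′ (inj₂ r) ¬q e = [ inj₂ ∘ inj₁ , inj₁ ∘ inj₂ ]′ (closed a r e)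
        start′ : ∀ {u} → (X u ⊎ Q u) ⊎ (u ≡ p ⊎ R u) → (X′ u ⊎ Q′ u) ⊎ (u ≡ v ⊎ Region b u)
        start′ (inj₁ (inj₁ x))        = inj₁ (inj₁ (inj₁ x))
        start′ (inj₁ (inj₂ q))        = inj₁ (inj₂ (inj₂ q))
        start′ (inj₂ (inj₁ eq))       = inj₁ (inj₂ (inj₁ eq))
        start′ (inj₂ (inj₂ (inj₁ r))) = inj₂ r
        start′ (inj₂ (inj₂ (inj₂ r))) = inj₁ (inj₁ (inj₂ r))
        middle : ∀ {u} → X′ u ⊎ Q′ u → (X u ⊎ Q u) ⊎ (u ≡ p ⊎ Region a u)
        middle (inj₁ (inj₁ x))  = inj₁ (inj₁ x)
        middle (inj₁ (inj₂ r))  = inj₂ (inj₂ r)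
        middle (inj₂ (inj₁ eq)) = inj₂ (inj₁ eq)
        middle (inj₂ (inj₂ q))  = inj₁ (inj₂ q)

    -- First `a` is cleared with a guard on `p`, then `b` without it. The round between them is
    -- needed because the mouse may enter `p` in the move after the last guarded round; the cat on
    -- `v` prevents a move from `v` to `p` in that same round.
    graft-heavy : size a ≤ size b → Branch p
    graft-heavy a≤b = record
      { Region = R
      ; size   = size b + size a
      ; bags   = guard p (bags a) ++ (⁅ p ⁆ ∪ ⁅ v ⁆) ∷ bags b
      ; closed = R-closed
      ; size>0 = size>0′
      ; narrow = narrow′
      ; clears = λ {Q} {X} → clears′ {Q} {X}
      }
      where
      narrow′ : ∀ k → size b + size a < 2 ^ k →
                All (λ B → ∣ B ∣ ≤ k) (guard p (bags a) ++ (⁅ p ⁆ ∪ ⁅ v ⁆) ∷ bags b)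
      narrow′ zero          s< = contradiction size>0′ (ℕ.<⇒≱ s<)
      -- Both sizes are positive, so their sum is at least 2 and two cats are available for the
      -- round on `p` and `v`.
      narrow′ (suc zero)    s< = contradiction (ℕ.+-mono-≤ (size>0 b) (size>0 a)) (ℕ.<⇒≱ s<)
      narrow′ (suc (suc k)) s< = All.++⁺
        (guard-narrow (narrow a (suc k)
          (x≤y⇒x+y<2^1+k⇒x<2^k (suc k) a≤b (subst (_< 2 ^ (2 + k)) (ℕ.+-comm (size b) (size a)) s<))))
        (ℕ.≤-trans (∣⁅x⁆∪p∣≤1+∣p∣ p ⁅ v ⁆) (s≤s (ℕ.≤-trans (ℕ.≤-reflexive (∣⁅x⁆∣≡1 v)) (s≤s z≤n)))
         ∷ narrow b (2 + k) (ℕ.≤-<-trans (ℕ.m≤m+n (size b) (size a)) s<))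
      clears′ : ∀ {Q X : Pred (Fin n) 0ℓ} → (∀ {v w} → X v → ¬ Q v → v ~ w → X w ⊎ Q w) →
                ∀ {u w} → (X u ⊎ Q u) ⊎ (u ≡ p ⊎ R u) →
                Evade Q (guard p (bags a) ++ (⁅ p ⁆ ∪ ⁅ v ⁆) ∷ bags b) u w → X w ⊎ Q w
      clears′ {Q} {X} outer {u} {w} start e with evade-++ (guard p (bags a)) e
      ... | m , e₁ , (¬q , m∉ , m′ , m~m′ , e₂) =
        clears b outer (middle (clears a {Q′} {X′} outer′ (start′ start) (evade-guard (bags a) e₁))) e₂
        where
        Q′ X′ : Pred (Fin n) 0ℓ
        Q′ x = x ≡ p ⊎ Q x
        X′ x = X x ⊎ (x ≡ v ⊎ Region b x)
        outer′ : ∀ {v w} → X′ v → ¬ Q′ v → v ~ w → X′ w ⊎ Q′ w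
        outer′ (inj₁ x)           ¬q e = [ inj₁ ∘ inj₁ , inj₂ ∘ inj₂ ]′ (outer x (¬q ∘ inj₂) e)
        outer′ (inj₂ (inj₁ refl)) ¬q e = [ inj₂ ∘ inj₁ , inj₁ ∘ inj₂ ∘ inj₂ ]′ (nbrs e)
        outer′ (inj₂ (inj₂ r))    ¬q e = inj₁ (inj₂ (closed b r e))
        start′ : ∀ {u} → (X u ⊎ Q u) ⊎ (u ≡ p ⊎ R u) → (X′ u ⊎ Q′ u) ⊎ (u ≡ p ⊎ Region a u)
        start′ (inj₁ (inj₁ x))        = inj₁ (inj₁ (inj₁ x))
        start′ (inj₁ (inj₂ q))        = inj₁ (inj₂ (inj₂ q))
        start′ (inj₂ (inj₁ eq))       = inj₂ (inj₁ eq)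
        start′ (inj₂ (inj₂ (inj₁ r))) = inj₁ (inj₁ (inj₂ r))
        start′ (inj₂ (inj₂ (inj₂ r))) = inj₂ (inj₂ r)
        middle : X′ m ⊎ Q′ m → (X m′ ⊎ Q m′) ⊎ (m′ ≡ v ⊎ Region b m′)
        middle (inj₁ (inj₁ x))           = inj₁ (outer x ¬q m~m′)
        middle (inj₁ (inj₂ (inj₁ refl))) = contradiction (q⊆p∪q ⁅ p ⁆ ⁅ v ⁆ (x∈⁅x⁆ v)) m∉
        middle (inj₁ (inj₂ (inj₂ r)))    = inj₂ (closed b r m~m′)
        middle (inj₂ (inj₁ refl))        = contradiction (p⊆p∪q ⁅ v ⁆ (x∈⁅x⁆ p)) m∉
        middle (inj₂ (inj₂ q))           = contradiction q ¬q

    graft : Σ[ c ∈ Branch p ] size c ≡ size b + size a × (∀ {x} → x ≡ v ⊎ Region a x → Region c x)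
    graft with ℕ.≤-total (size b) (size a)
    ... | inj₁ b≤a = graft-light b≤a , refl , [ inj₁ ∘ inj₁ , inj₂ ]′
    ... | inj₂ a≤b = graft-heavy a≤b , refl , [ inj₁ ∘ inj₁ , inj₂ ]′

  -- Adding and pruning leaves

  data Grown : List (Fin n) → Set where
    root   : ∀ r → Grown (r ∷ [])
    attach : ∀ {w u L} → Grown L → u ∈ₗ L → w ∉ₗ L → u ~ w →
             (∀ {x} → x ∈ₗ L → w ~ x → x ≡ u) → Grown (w ∷ L)

  grown-unique : ∀ {L} → Grown L → Unique L
  grown-unique (root r)              = [] ∷ []
  grown-unique (attach g _ w∉ _ _) = All.¬Any⇒All¬ _ w∉ ∷ grown-unique g

  -- The vertices of L are removed in reverse order; sub v collects what has
  -- been removed below v.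
  prune : ∀ {L} → Grown L → (sub : ∀ v → Branch v) →
          (∀ {v z} → v ∈ₗ L → z ∉ₗ L → v ~ z → Region (sub v) z) →
          ∃[ r ] Σ[ b ∈ Branch r ] size b ≡ sum (map (size ∘ sub) L) × (∀ {z} → r ~ z → Region b z)
  prune (root r) sub below = r , sub r , sym (ℕ.+-identityʳ _) ,
    λ r~z → below (here refl) (λ { (here refl) → ~-irrefl r~z }) r~z
  prune (attach {w} {u} {L} g u∈ w∉ u~w only-u) sub below =
    let r , b , size≡ , nbrs = prune g sub′ below′
    in r , b , trans size≡ (sum-update (grown-unique g) u∈ size-u size-else) , nbrs
    where
    w-nbrs : ∀ {x} → w ~ x → x ≡ u ⊎ Region (sub w) x
    w-nbrs {x} w~x with DecMembership._∈?_ Fin._≟_ x L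
    ... | yes x∈ = inj₁ (only-u x∈ w~x)
    ... | no  x∉ = inj₂ (below (here refl) (λ { (here refl) → ~-irrefl w~x ; (there x∈) → x∉ x∈ }) w~x)
    grafted = graft (sub w) (sub u) w-nbrs
    sub′ : ∀ v → Branch v
    sub′ v with v Fin.≟ u
    ... | yes refl = proj₁ grafted
    ... | no  _    = sub v
    below′ : ∀ {v z} → v ∈ₗ L → z ∉ₗ L → v ~ z → Region (sub′ v) z
    below′ {v} {z} v∈ z∉ v~z with v Fin.≟ u | z Fin.≟ w
    ... | yes refl | yes refl = proj₂ (proj₂ grafted) (inj₁ refl)
    ... | yes refl | no z≢w   = proj₂ (proj₂ grafted) (inj₂ (below (there v∈) (λ { (here eq) → z≢w eq ; (there z∈) → z∉ z∈ }) v~z))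
    ... | no v≢u   | yes refl = contradiction (only-u v∈ (~-sym v~z)) v≢u
    ... | no v≢u   | no z≢w   = below (there v∈) (λ { (here eq) → z≢w eq ; (there z∈) → z∉ z∈ }) v~z
    size-u : size (sub′ u) ≡ size (sub w) + size (sub u)
    size-u with u Fin.≟ u
    ... | yes refl = proj₁ (proj₂ grafted)
    ... | no  u≢u  = contradiction refl u≢u
    size-else : ∀ {x} → x ≢ u → size (sub′ x) ≡ size (sub x)
    size-else {x} x≢u with x Fin.≟ u
    ... | yes refl = contradiction refl x≢u
    ... | no  _    = refl

  -- Simple paths and cycles

  data Path : Fin n → Fin n → List (Fin n) → Set where
    [_] : ∀ x → Path x x (x ∷ [])
    _∷_ : ∀ {x y z vs} → x ~ y → Path y z vs → Path x z (x ∷ vs)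

  path-snoc : ∀ {x y z vs} → Path x y vs → y ~ z → Path x z (vs ++ z ∷ [])
  path-snoc [ x ]   e  = e ∷ [ _ ]
  path-snoc (d ∷ p) e = d ∷ path-snoc p e

  path-head : ∀ {x y v vs} → Path x y (v ∷ vs) → v ≡ x
  path-head [ _ ]   = refl
  path-head (_ ∷ _) = refl

  path-last : ∀ {x y v vs} → Path x y (v ∷ vs) → lookup (v ∷ vs) (fromℕ (length vs)) ≡ y
  path-last [ _ ]               = refl
  path-last {vs = _ ∷ _} (_ ∷ p) = path-last p

  path-walk : ∀ {x y vs} → Path x y vs → IsWalk G (lookup vs)
  path-walk [ x ] zero zero ()
  path-walk (_∷_ {vs = _ ∷ _} e p) zero (suc zero) _ = subst (_ ~_) (sym (path-head p)) e
  path-walk (e ∷ p) (suc i) (suc j) eq = path-walk p i j (ℕ.suc-injective eq)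

  -- A walk between distinct neighbours of a vertex that it avoids closes up.
  path-cycle : ∀ {w x y vs} → Path x y vs → Unique (w ∷ vs) → x ≢ y → w ~ x → w ~ y → Cycle G
  path-cycle [ x ] _ x≢y = contradiction refl x≢y
  path-cycle {w} {vs = vs} p@(_∷_ {vs = _ ∷ _} _ _) uniq _ w~x w~y = record
    { vertex    = lookup (w ∷ vs)
    ; injective = unique⇒lookup-injective uniq
    ; isWalk    = path-walk (w~x ∷ p)
    ; closes    = subst (_~ w) (sym (path-last p)) (~-sym w~y)
    }

  SimplePath : Fin n → Fin n → List (Fin n) → Set
  SimplePath x y L = ∃[ vs ] Path x y vs × Unique vs × All (_∈ₗ L) vs

  grown-path : ∀ {L x y} → Grown L → x ∈ₗ L → y ∈ₗ L → SimplePath x y L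
  grown-path (root r) (here refl) (here refl) = _ , [ r ] , [] ∷ [] , here refl ∷ []
  grown-path (attach g u∈ w∉ u~w _) (here refl) (here refl) = _ , [ _ ] , [] ∷ [] , here refl ∷ []
  grown-path (attach g u∈ w∉ u~w _) (here refl) (there y∈) =
    let vs , p , uniq , vs∈ = grown-path g u∈ y∈
    in _ , ~-sym u~w ∷ p , All.map (λ v∈ → λ { refl → w∉ v∈ }) vs∈ ∷ uniq , here refl ∷ All.map there vs∈
  grown-path (attach g u∈ w∉ u~w _) (there x∈) (here refl) =
    let vs , p , uniq , vs∈ = grown-path g x∈ u∈
    in _ , path-snoc p u~w
       , Unique.++⁺ uniq ([] ∷ []) (λ { (v∈ , here refl) → w∉ (All.lookup vs∈ v∈) })
       , All.++⁺ (All.map there vs∈) (here refl ∷ [])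
  grown-path (attach g u∈ w∉ u~w _) (there x∈) (there y∈) =
    let vs , p , uniq , vs∈ = grown-path g x∈ y∈ in vs , p , uniq , All.map there vs∈

  crossing : ∀ {L x y} → Star _~_ x y → x ∈ₗ L → y ∉ₗ L → ∃[ u ] ∃[ w ] u ∈ₗ L × w ∉ₗ L × u ~ w
  crossing ε x∈ y∉ = contradiction x∈ y∉
  crossing {L} (_◅_ {j = z} e es) x∈ y∉ with DecMembership._∈?_ Fin._≟_ z L
  ... | yes z∈ = crossing es z∈ y∉
  ... | no  z∉ = _ , _ , x∈ , z∉ , e

  -- Every tree is obtained by adding leaves

  module _ (tree : IsTree G) where
    open IsTree tree

    grow : ∀ {L} → Grown L → (∀ v → v ∈ₗ L) ⊎ ∃[ w ] Grown (w ∷ L)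
    grow {L} g with Fin.all? (λ v → DecMembership._∈?_ Fin._≟_ v L)
    ... | yes all  = inj₁ all
    ... | no  ¬all with Fin.¬∀⟶∃¬ n (_∈ₗ L) (λ v → DecMembership._∈?_ Fin._≟_ v L) ¬all
    ...   | y , y∉ = let u , w , u∈ , w∉ , u~w = crossing (connected _ y) (proj₂ (member g)) y∉
                     in inj₂ (w , attach g u∈ w∉ u~w (only-u u∈ w∉ u~w))
      where
      member : ∀ {L} → Grown L → ∃[ x ] x ∈ₗ L
      member (root r)           = r , here refl
      member (attach _ _ _ _ _) = _ , here refl
      only-u : ∀ {u w} → u ∈ₗ L → w ∉ₗ L → u ~ w → ∀ {x} → x ∈ₗ L → w ~ x → x ≡ u
      only-u {u} {w} u∈ w∉ u~w {x} x∈ w~x with x Fin.≟ u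
      ... | yes eq = eq
      -- A second neighbour of `w` in `L` would close a cycle: the simple path from `x` to `u` stays
      -- in `L` and avoids `w`.
      ... | no x≢u = let vs , p , uniq , vs∈ = grown-path g x∈ u∈ in contradiction
        (path-cycle p (All.map (λ v∈ → λ { refl → w∉ v∈ }) vs∈ ∷ uniq) x≢u w~x (~-sym u~w)) acyclic

    grown-length : ∀ {L} → Grown L → length L ≤ n
    grown-length g = Fin.injective⇒≤ (unique⇒lookup-injective (grown-unique g))

    -- `k` is fuel. At `k = 0` the list would hold n + 1 distinct vertices, so growth has stopped
    -- before.
    grow-all : ∀ {L} k → k + length L ≡ suc n → Grown L → ∃[ L ] Grown L × (∀ v → v ∈ₗ L)
    grow-all zero    eq g = contradiction (grown-length g) (ℕ.<⇒≱ (ℕ.≤-reflexive (sym eq)))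
    grow-all (suc k) eq g with grow g
    ... | inj₁ all      = _ , g , all
    ... | inj₂ (w , g′) = grow-all k (trans (ℕ.+-suc k _) eq) g′

    spanned : ∃[ L ] Grown L × (∀ v → v ∈ₗ L)
    spanned = grow-all n (ℕ.+-comm n 1) (root (vertex₀ nonEmpty))
      where
      vertex₀ : ∀ {m} → NonZero m → Fin m
      vertex₀ {suc m} _ = zero

    catWin-tree : ∀ k → n < 2 ^ k → CatWin G k
    catWin-tree k n<2^k =
      beats⇒catWin (narrow b k (ℕ.≤-<-trans size≤n n<2^k) , λ u w e →
        -- With nothing guarded and nothing contaminated outside, clearing leaves the mouse no
        -- position at all.
        [ id , id ]′ (clears b {Free} {Free} (λ ()) (inj₂ (covered (connected r u) (inj₁ refl))) e))
      where
      L       = proj₁ spanned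
      grown   = proj₁ (proj₂ spanned)
      pruned  = prune grown bare (λ {v} {z} _ z∉ _ → z∉ (proj₂ (proj₂ spanned) z))
      r       = proj₁ pruned
      b       = proj₁ (proj₂ pruned)
      size≡   = proj₁ (proj₂ (proj₂ pruned))
      nbrs    = proj₂ (proj₂ (proj₂ pruned))
      count : ∀ (L : List (Fin n)) → sum (map (size ∘ bare) L) ≡ length L
      count []      = refl
      count (_ ∷ L) = cong suc (count L)
      size≤n : size b ≤ n
      size≤n = ℕ.≤-trans (ℕ.≤-reflexive (trans size≡ (count L))) (grown-length grown)
      covered : ∀ {x y} → Star _~_ x y → x ≡ r ⊎ Region b x → y ≡ r ⊎ Region b y
      covered ε        x           = x
      covered (e ◅ es) (inj₁ refl) = covered es (inj₂ (nbrs e))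
      covered (e ◅ es) (inj₂ x)    = covered es (closed b x e)

n<2^[1+⌊log₂n⌋] : ∀ n → n < 2 ^ suc ⌊log₂ n ⌋
n<2^[1+⌊log₂n⌋] n = ℕ.≰⇒> λ 2^≤n → ℕ.1+n≰n
  (ℕ.≤-trans (ℕ.≤-reflexive (sym (⌊log₂[2^n]⌋≡n (suc ⌊log₂ n ⌋)))) (⌊log₂⌋-mono-≤ 2^≤n))

h-tree≤ : ∀ {n r} {T : Graph n} → IsTree T → h T ≈ r → r ≤ suc ⌊log₂ n ⌋
h-tree≤ {n} {T = T} tree (_ , min) = min _ (Clearing.catWin-tree T tree _ (n<2^[1+⌊log₂n⌋] n))

-- Signed binary representations

-- Base 2, lowest digit first. Digits are arbitrary integers, so addition needs no carries and a
-- digit d stands for |d| equal terms.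
value : List ℤ → ℤ
value []       = + 0
value (d ∷ ds) = d ℤ.+ + 2 ℤ.* value ds

weight : List ℤ → ℕ
weight []       = 0
weight (d ∷ ds) = ℤ.∣ d ∣ + weight ds

_⊞_ : List ℤ → List ℤ → List ℤ
[]       ⊞ es       = es
(d ∷ ds) ⊞ []       = d ∷ ds
(d ∷ ds) ⊞ (e ∷ es) = (d ℤ.+ e) ∷ (ds ⊞ es)

value-⊞ : ∀ ds es → value (ds ⊞ es) ≡ value ds ℤ.+ value es
value-⊞ []       es       = sym (ℤ.+-identityˡ _)
value-⊞ (d ∷ ds) []       = sym (ℤ.+-identityʳ _)
value-⊞ (d ∷ ds) (e ∷ es) = begin
  d ℤ.+ e ℤ.+ + 2 ℤ.* value (ds ⊞ es)            ≡⟨ cong (λ v → d ℤ.+ e ℤ.+ + 2 ℤ.* v) (value-⊞ ds es) ⟩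
  d ℤ.+ e ℤ.+ + 2 ℤ.* (value ds ℤ.+ value es)    ≡⟨ regroup d e (value ds) (value es) ⟩
  value (d ∷ ds) ℤ.+ value (e ∷ es)              ∎
  where
  open ≡-Reasoning
  regroup : ∀ d e x y → d ℤ.+ e ℤ.+ + 2 ℤ.* (x ℤ.+ y) ≡ (d ℤ.+ + 2 ℤ.* x) ℤ.+ (e ℤ.+ + 2 ℤ.* y)
  regroup = ℤ-solve-∀

weight-⊞ : ∀ ds es → weight (ds ⊞ es) ≤ weight ds + weight es
weight-⊞ []       es       = ℕ.≤-refl
weight-⊞ (d ∷ ds) []       = ℕ.m≤m+n _ 0
weight-⊞ (d ∷ ds) (e ∷ es) = begin
  ℤ.∣ d ℤ.+ e ∣ + weight (ds ⊞ es)                      ≤⟨ ℕ.+-mono-≤ (ℤ.∣i+j∣≤∣i∣+∣j∣ d e) (weight-⊞ ds es) ⟩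
  (ℤ.∣ d ∣ + ℤ.∣ e ∣) + (weight ds + weight es)         ≡⟨ regroup ℤ.∣ d ∣ ℤ.∣ e ∣ (weight ds) (weight es) ⟩
  (ℤ.∣ d ∣ + weight ds) + (ℤ.∣ e ∣ + weight es)         ∎
  where
  open ℕ.≤-Reasoning
  regroup : ∀ a b c d → (a + b) + (c + d) ≡ (a + c) + (b + d)
  regroup = solve-∀

-- m is a sum of at most w terms ± 2^j.
record Rep (w : ℕ) (m : ℤ) : Set where
  constructor rep
  field
    digits  : List ℤ
    value≡  : value digits ≡ m
    weight≤ : weight digits ≤ w

rep-0 : Rep 0 (+ 0)
rep-0 = rep [] refl z≤n

rep-+ : ∀ {w w′ m m′} → Rep w m → Rep w′ m′ → Rep (w + w′) (m ℤ.+ m′)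
rep-+ (rep ds v b) (rep es v′ b′) =
  rep (ds ⊞ es) (trans (value-⊞ ds es) (cong₂ ℤ._+_ v v′)) (ℕ.≤-trans (weight-⊞ ds es) (ℕ.+-mono-≤ b b′))

rep-digit : ∀ m → Rep ℤ.∣ m ∣ m
rep-digit m = rep (m ∷ []) (ℤ.+-identityʳ m) (ℕ.≤-reflexive (ℕ.+-identityʳ _))

rep-double : ∀ {w m} → Rep w m → Rep w (+ 2 ℤ.* m)
rep-double (rep ds v b) = rep (+ 0 ∷ ds) (trans (ℤ.+-identityˡ _) (cong (+ 2 ℤ.*_) v)) b

rep-weaken : ∀ {w w′ m} → w ≤ w′ → Rep w m → Rep w′ m
rep-weaken w≤ (rep ds v b) = rep ds v (ℕ.≤-trans b w≤)

rep-2^ : ∀ k d → Rep ℤ.∣ d ∣ (d ℤ.* + (2 ^ k))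
rep-2^ zero    d = subst (Rep _) (sym (ℤ.*-identityʳ d)) (rep-digit d)
rep-2^ (suc k) d = subst (Rep _) eq (rep-double (rep-2^ k d))
  where
  swap : ∀ d p → + 2 ℤ.* (d ℤ.* p) ≡ d ℤ.* (+ 2 ℤ.* p)
  swap = ℤ-solve-∀
  eq : + 2 ℤ.* (d ℤ.* + (2 ^ k)) ≡ d ℤ.* + (2 ^ suc k)
  eq = trans (swap d (+ (2 ^ k))) (cong (d ℤ.*_) (sym (ℤ.pos-* 2 (2 ^ k))))

-- 10101…01 in binary, with K ones.
alternating : ℕ → ℕ
alternating zero    = 0
alternating (suc K) = 1 + 4 * alternating K

unit-digit : List ℤ → ℤ
unit-digit []      = + 0
unit-digit (d ∷ _) = d

higher : List ℤ → List ℤ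
higher []       = []
higher (_ ∷ ds) = ds

value-split : ∀ ds → value ds ≡ unit-digit ds ℤ.+ + 2 ℤ.* value (higher ds)
value-split []       = refl
value-split (_ ∷ _) = refl

weight-split : ∀ ds → weight ds ≡ ℤ.∣ unit-digit ds ∣ + weight (higher ds)
weight-split []       = refl
weight-split (_ ∷ _) = refl

-- Replacing the two lowest digits a, b of 1 + 4 m by a carry t into the rest
-- saves at least one unit of weight.
carry-saves : ∀ a b t → a ℤ.+ + 2 ℤ.* b ≡ + 1 ℤ.+ + 4 ℤ.* t → suc ℤ.∣ t ∣ ≤ ℤ.∣ a ∣ + ℤ.∣ b ∣
-- Otherwise |a| + |b| ≤ |t|, yet |a + 2 b| ≤ 2 (|a| + |b|) while |1 + 4 t| > 2 |t|.
carry-saves a b t eq = ℕ.≰⇒> λ small → ℕ.<⇒≱ (large t small) (begin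
  ℤ.∣ + 1 ℤ.+ + 4 ℤ.* t ∣       ≡⟨ cong ℤ.∣_∣ (sym eq) ⟩
  ℤ.∣ a ℤ.+ + 2 ℤ.* b ∣         ≤⟨ ℤ.∣i+j∣≤∣i∣+∣j∣ a (+ 2 ℤ.* b) ⟩
  ℤ.∣ a ∣ + ℤ.∣ + 2 ℤ.* b ∣     ≡⟨ cong (λ w → ℤ.∣ a ∣ + w) (ℤ.abs-* (+ 2) b) ⟩
  ℤ.∣ a ∣ + 2 * ℤ.∣ b ∣         ≤⟨ ℕ.+-monoˡ-≤ _ (ℕ.m≤n*m ℤ.∣ a ∣ 2) ⟩
  2 * ℤ.∣ a ∣ + 2 * ℤ.∣ b ∣     ≡⟨ sym (ℕ.*-distribˡ-+ 2 ℤ.∣ a ∣ ℤ.∣ b ∣) ⟩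
  2 * (ℤ.∣ a ∣ + ℤ.∣ b ∣)       ∎)
  where
  open ℕ.≤-Reasoning
  large : ∀ t {j} → j ≤ ℤ.∣ t ∣ → 2 * j < ℤ.∣ + 1 ℤ.+ + 4 ℤ.* t ∣
  large (+ s) {j} j≤s = begin-strict
    2 * j                          ≤⟨ ℕ.*-monoʳ-≤ 2 j≤s ⟩
    2 * s                          ≤⟨ ℕ.*-monoˡ-≤ s (s≤s (s≤s (z≤n {2}))) ⟩
    4 * s                          <⟨ ℕ.n<1+n _ ⟩
    1 + 4 * s                      ≡⟨ cong (λ i → ℤ.∣ + 1 ℤ.+ i ∣) (ℤ.pos-* 4 s) ⟩
    ℤ.∣ + 1 ℤ.+ + 4 ℤ.* + s ∣      ∎
  large -[1+ s ] {j} j≤s = begin-strict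
    2 * j                          ≤⟨ ℕ.*-monoʳ-≤ 2 j≤s ⟩
    2 * suc s                      <⟨ ℕ.m<m+n (2 * suc s) {suc (2 * s)} (s≤s z≤n) ⟩
    2 * suc s + suc (2 * s)        ≡⟨ regroup s ⟩
    3 + 4 * s                      ≡⟨ cong ℤ.∣_∣ (eq′ s) ⟩
    ℤ.∣ + 1 ℤ.+ + 4 ℤ.* -[1+ s ] ∣ ∎
    where
    regroup : ∀ s → 2 * suc s + suc (2 * s) ≡ 3 + 4 * s
    regroup = solve-∀
    negate : ∀ x → ℤ.- (+ 3 ℤ.+ + 4 ℤ.* x) ≡ + 1 ℤ.+ + 4 ℤ.* (ℤ.- (+ 1 ℤ.+ x))
    negate = ℤ-solve-∀
    eq′ : ∀ s → ℤ.- (+ (3 + 4 * s)) ≡ + 1 ℤ.+ + 4 ℤ.* -[1+ s ]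
    eq′ s = trans (cong (λ i → ℤ.- (+ 3 ℤ.+ i)) (ℤ.pos-* 4 s)) (negate (+ s))

-- Induction by division by 4: the two lowest digits become a carry `t` into the rest. The new
-- digits represent `alternating K`, and by `carry-saves` their weight is smaller by at least one.
alternating-heavy : ∀ K ds → value ds ≡ + alternating K → K ≤ weight ds
alternating-heavy zero    ds eq = z≤n
alternating-heavy (suc K) ds eq = begin
  suc K                                         ≤⟨ s≤s (alternating-heavy K ((t ∷ []) ⊞ rest) carried) ⟩
  suc (weight ((t ∷ []) ⊞ rest))                  ≤⟨ s≤s (weight-⊞ (t ∷ []) rest) ⟩
  suc (ℤ.∣ t ∣ + 0 + weight rest)               ≡⟨ cong (λ w → suc (w + weight rest)) (ℕ.+-identityʳ ℤ.∣ t ∣) ⟩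
  suc ℤ.∣ t ∣ + weight rest                     ≤⟨ ℕ.+-monoˡ-≤ (weight rest) (carry-saves a b t low) ⟩
  ℤ.∣ a ∣ + ℤ.∣ b ∣ + weight rest               ≡⟨ ℕ.+-assoc ℤ.∣ a ∣ ℤ.∣ b ∣ _ ⟩
  ℤ.∣ a ∣ + (ℤ.∣ b ∣ + weight rest)             ≡⟨ cong (λ w → ℤ.∣ a ∣ + w) (sym (weight-split (higher ds))) ⟩
  ℤ.∣ a ∣ + weight (higher ds)                  ≡⟨ sym (weight-split ds) ⟩
  weight ds                                     ∎
  where
  open ℕ.≤-Reasoning
  a = unit-digit ds
  b = unit-digit (higher ds)
  rest = higher (higher ds)
  t = + alternating K ℤ.- value rest
  carried : value ((t ∷ []) ⊞ rest) ≡ + alternating K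
  carried = trans (value-⊞ (t ∷ []) rest) (cancel (+ alternating K) (value rest))
    where
    cancel : ∀ m v → (m ℤ.- v) ℤ.+ + 0 ℤ.+ v ≡ m
    cancel = ℤ-solve-∀
  low : a ℤ.+ + 2 ℤ.* b ≡ + 1 ℤ.+ + 4 ℤ.* t
  low = ≡.begin
    a ℤ.+ + 2 ℤ.* b
      ≡.≡⟨ isolate a b (value rest) ⟩
    (a ℤ.+ + 2 ℤ.* (b ℤ.+ + 2 ℤ.* value rest)) ℤ.- + 4 ℤ.* value rest
      ≡.≡⟨ cong (λ v → (a ℤ.+ + 2 ℤ.* v) ℤ.- + 4 ℤ.* value rest) (sym (value-split (higher ds))) ⟩
    (a ℤ.+ + 2 ℤ.* value (higher ds)) ℤ.- + 4 ℤ.* value rest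
      ≡.≡⟨ cong (ℤ._- + 4 ℤ.* value rest) (trans (sym (value-split ds)) eq) ⟩
    + (1 + 4 * alternating K) ℤ.- + 4 ℤ.* value rest
      ≡.≡⟨ cong (λ i → (+ 1 ℤ.+ i) ℤ.- + 4 ℤ.* value rest) (ℤ.pos-* 4 (alternating K)) ⟩
    (+ 1 ℤ.+ + 4 ℤ.* + alternating K) ℤ.- + 4 ℤ.* value rest
      ≡.≡⟨ factor (+ alternating K) (value rest) ⟩
    + 1 ℤ.+ + 4 ℤ.* t  ≡.∎
    where
    module ≡ = ≡-Reasoning
    isolate : ∀ a b v → a ℤ.+ + 2 ℤ.* b ≡ (a ℤ.+ + 2 ℤ.* (b ℤ.+ + 2 ℤ.* v)) ℤ.- + 4 ℤ.* v
    isolate = ℤ-solve-∀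
    factor : ∀ m v → (+ 1 ℤ.+ + 4 ℤ.* m) ℤ.- + 4 ℤ.* v ≡ + 1 ℤ.+ + 4 ℤ.* (m ℤ.- v)
    factor = ℤ-solve-∀

rep-alternating : ∀ {w} K → Rep w (+ alternating K) → K ≤ w
rep-alternating K (rep ds v b) = ℕ.≤-trans (alternating-heavy K ds v) b

-- Edge sums over perfect binary trees in heap order

-- The children of the node i are i + i and suc (i + i); k is the height of
-- the tree below i, and β is a 2-colour of i that alternates along edges.
Σₑ : ℕ → ℕ → Bool → (Bool → ℕ → ℕ → ℕ) → ℕ
Σₑ zero    i β g = 0
Σₑ (suc k) i β g = (g β i (i + i) + Σₑ k (i + i) (not β) g)
                 + (g β i (suc (i + i)) + Σₑ k (suc (i + i)) (not β) g)

Σᵥ : ℕ → ℕ → (ℕ → ℕ) → ℕ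
Σᵥ zero    i f = f i
Σᵥ (suc k) i f = f i + (Σᵥ k (i + i) f + Σᵥ k (suc (i + i)) f)

Σₑ-1 : ∀ k i β → 2 + Σₑ k i β (λ _ _ _ → 1) ≡ 2 ^ suc k
Σₑ-1 zero    i β = refl
Σₑ-1 (suc k) i β = begin
  2 + ((1 + l) + (1 + r))  ≡⟨ regroup l r ⟩
  (2 + l) + (2 + r)        ≡⟨ cong₂ _+_ (Σₑ-1 k (i + i) (not β)) (Σₑ-1 k (suc (i + i)) (not β)) ⟩
  2 ^ suc k + 2 ^ suc k    ≡⟨ cong (λ x → 2 ^ suc k + x) (sym (ℕ.+-identityʳ _)) ⟩
  2 ^ suc (suc k)          ∎
  where
  open ≡-Reasoning
  l = Σₑ k (i + i) (not β) (λ _ _ _ → 1)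
  r = Σₑ k (suc (i + i)) (not β) (λ _ _ _ → 1)
  regroup : ∀ l r → 2 + ((1 + l) + (1 + r)) ≡ (2 + l) + (2 + r)
  regroup = solve-∀

Σₑ-mono : ∀ {g g′} → (∀ β p q → g β p q ≤ g′ β p q) → ∀ k i β → Σₑ k i β g ≤ Σₑ k i β g′
Σₑ-mono le zero    i β = z≤n
Σₑ-mono le (suc k) i β = ℕ.+-mono-≤ (ℕ.+-mono-≤ (le β i _) (Σₑ-mono le k _ _))
                                     (ℕ.+-mono-≤ (le β i _) (Σₑ-mono le k _ _))

Σₑ-+ : ∀ g g′ k i β → Σₑ k i β (λ β p q → g β p q + g′ β p q) ≡ Σₑ k i β g + Σₑ k i β g′
Σₑ-+ g g′ zero    i β = refl
Σₑ-+ g g′ (suc k) i β = begin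
  _ ≡⟨ cong₂ (λ l r → (a + a′ + l) + (b + b′ + r)) (Σₑ-+ g g′ k _ _) (Σₑ-+ g g′ k _ _) ⟩
  _ ≡⟨ regroup a a′ _ _ b b′ _ _ ⟩
  _ ∎
  where
  open ≡-Reasoning
  a  = g β i (i + i)
  a′ = g′ β i (i + i)
  b  = g β i (suc (i + i))
  b′ = g′ β i (suc (i + i))
  regroup : ∀ a a′ l l′ b b′ r r′ → (a + a′ + (l + l′)) + (b + b′ + (r + r′)) ≡
                                    ((a + l) + (b + r)) + ((a′ + l′) + (b′ + r′))
  regroup = solve-∀

IsParent : ℕ → ℕ → Set
IsParent p q = ⌊ q /2⌋ ≡ p

parent-even : ∀ p → IsParent p (p + p)
parent-even p = sym (ℕ.n≡⌊n+n/2⌋ p)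

parent-odd : ∀ p → IsParent p (suc (p + p))
parent-odd p = sym (ℕ.n≡⌈n+n/2⌉ p)

module _ (n : ℕ) where

  private
    even-fits : ∀ {k} i → suc i * 2 ^ suc k ≤ suc n → suc (i + i) * 2 ^ k ≤ suc n
    even-fits {k} i fits = ℕ.≤-trans (ℕ.≤-trans (ℕ.*-monoˡ-≤ (2 ^ k) (ℕ.n≤1+n (suc (i + i))))
                             (ℕ.≤-reflexive (regroup i (2 ^ k)))) fits
      where
      regroup : ∀ i x → suc (suc (i + i)) * x ≡ suc i * (2 * x)
      regroup = solve-∀
    odd-fits : ∀ {k} i → suc i * 2 ^ suc k ≤ suc n → suc (suc (i + i)) * 2 ^ k ≤ suc n
    odd-fits {k} i fits = ℕ.≤-trans (ℕ.≤-reflexive (regroup i (2 ^ k))) fits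
      where
      regroup : ∀ i x → suc (suc (i + i)) * x ≡ suc i * (2 * x)
      regroup = solve-∀
    fits⇒≤ : ∀ {k q} → suc q * 2 ^ k ≤ suc n → q ≤ n
    fits⇒≤ {k} {q} fits = ℕ.≤-pred (ℕ.≤-trans (ℕ.m≤m*n (suc q) (2 ^ k) {{ℕ.m^n≢0 2 k}}) fits)

  -- The last node of the tree of height k below i is (i + 1) 2^k - 1, so the bound on
  -- `suc i * 2 ^ k` keeps all its nodes within 1, ..., n. Agreement is thus asked for on actual
  -- edges only.
  Σₑ-cong : ∀ {g g′} → (∀ β p q → 1 ≤ p → IsParent p q → q ≤ n → g β p q ≡ g′ β p q) →
            ∀ k i β → 1 ≤ i → suc i * 2 ^ k ≤ suc n → Σₑ k i β g ≡ Σₑ k i β g′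
  Σₑ-cong eq zero    i β 1≤i fits = refl
  Σₑ-cong eq (suc k) i β 1≤i fits = cong₂ _+_
    (cong₂ _+_ (eq β i _ 1≤i (parent-even i) (fits⇒≤ {k} even))
               (Σₑ-cong eq k _ _ (ℕ.≤-trans 1≤i (ℕ.m≤m+n i i)) even))
    (cong₂ _+_ (eq β i _ 1≤i (parent-odd i) (fits⇒≤ {k} odd))
               (Σₑ-cong eq k _ _ (s≤s z≤n) odd))
    where
    even = even-fits {k} i fits
    odd  = odd-fits {k} i fits

𝟙 : Bool → ℕ
𝟙 false = 0
𝟙 true  = 1

-- Edge isoperimetry

-- The number of inner edges (2 ^ (k + 1) - 2, or none) of a tree of height k
-- on which x is constant; half adds the edge above it.
full : Bool → ℕ → ℤ
full false k = + 0
full true  k = ℤ.- + 2 ℤ.+ + (2 ^ suc k)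

half : Bool → ℕ → ℤ
half false k = + 0
half true  k = ℤ.- + 1 ℤ.+ + (2 ^ suc k)

full-suc : ∀ b k → full b (suc k) ≡ half b k ℤ.+ half b k
full-suc false k = refl
full-suc true  k = trans (cong (λ i → ℤ.- + 2 ℤ.+ i) (ℤ.pos-* 2 (2 ^ suc k))) (double (+ (2 ^ suc k)))
  where
  double : ∀ p → ℤ.- + 2 ℤ.+ + 2 ℤ.* p ≡ (ℤ.- + 1 ℤ.+ p) ℤ.+ (ℤ.- + 1 ℤ.+ p)
  double = ℤ-solve-∀

rep-full : ∀ b k → Rep 2 (full b k)
rep-full false k = rep-weaken z≤n rep-0
rep-full true  k = subst (λ i → Rep 2 (ℤ.- + 2 ℤ.+ i)) (ℤ.*-identityˡ (+ (2 ^ suc k))) (rep-+ (rep-2^ 1 (ℤ.- + 1)) (rep-2^ (suc k) (+ 1)))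

-- b and c tell whether the upper and the lower end of an edge are in x, and
-- there are y inner edges below the lower end.
edge-rep : ∀ w y b c k → Rep (2 * w) (+ y ℤ.- full c k) →
           Rep (2 * 𝟙 (b xor c) + 2 * w) (+ 𝟙 (b ∧ c) ℤ.+ + y ℤ.- half b k)
edge-rep w y false false k r = subst (Rep _) refl r
edge-rep w y true true k r = subst (Rep _) (shift (+ y) (+ (2 ^ suc k))) r
  where
  shift : ∀ y p → y ℤ.- (ℤ.- + 2 ℤ.+ p) ≡ + 1 ℤ.+ y ℤ.- (ℤ.- + 1 ℤ.+ p)
  shift = ℤ-solve-∀
-- In this case and the next the edge is cut; its weight 2 pays for the two powers of two in
-- `half true k` or `full true k`.
edge-rep w y true false k r = subst (Rep _) (shift (+ y) (+ (2 ^ suc k)))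
  (rep-+ (rep-+ (rep-digit (+ 1)) (rep-2^ (suc k) (ℤ.- + 1))) r)
  where
  shift : ∀ y p → (+ 1 ℤ.+ (ℤ.- + 1) ℤ.* p) ℤ.+ (y ℤ.- + 0) ≡ + 0 ℤ.+ y ℤ.- (ℤ.- + 1 ℤ.+ p)
  shift = ℤ-solve-∀
edge-rep w y false true k r = subst (Rep _) (shift (+ y) (full true k)) (rep-+ (rep-full true k) r)
  where
  shift : ∀ y f → f ℤ.+ (y ℤ.- f) ≡ + 0 ℤ.+ y ℤ.- + 0
  shift = ℤ-solve-∀

module _ (x : Bool → ℕ → Bool) where

  inner cut : Bool → ℕ → ℕ → ℕ
  inner β p q = 𝟙 (x β p ∧ x (not β) q)
  cut   β p q = 𝟙 (x β p xor x (not β) q)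

  -- Without cut edges, `x` would be constant on the tree and the inner edges would number
  -- `full (x β i) k`. Going up the tree, each cut edge corrects this by two signed powers of two.
  iso : ∀ k i β → Rep (2 * Σₑ k i β cut) (+ Σₑ k i β inner ℤ.- full (x β i) k)
  iso zero    i β with x β i
  ... | false = rep-0
  ... | true  = rep-0
  iso (suc k) i β = subst₂ Rep (weights c₁ C₁ c₂ C₂) (values (+ d₁) (+ D₁) (+ d₂) (+ D₂) (x β i))
    (rep-+ (edge-rep C₁ D₁ (x β i) (x (not β) (i + i)) k (iso k (i + i) (not β)))
           (edge-rep C₂ D₂ (x β i) (x (not β) (suc (i + i))) k (iso k (suc (i + i)) (not β))))
    where
    c₁ = cut β i (i + i)
    c₂ = cut β i (suc (i + i))
    d₁ = inner β i (i + i)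
    d₂ = inner β i (suc (i + i))
    C₁ = Σₑ k (i + i) (not β) cut
    C₂ = Σₑ k (suc (i + i)) (not β) cut
    D₁ = Σₑ k (i + i) (not β) inner
    D₂ = Σₑ k (suc (i + i)) (not β) inner
    weights : ∀ a b c d → (2 * a + 2 * b) + (2 * c + 2 * d) ≡ 2 * ((a + b) + (c + d))
    weights = solve-∀
    regroup : ∀ a b c d y → (a ℤ.+ b ℤ.- y) ℤ.+ (c ℤ.+ d ℤ.- y) ≡
                            ((a ℤ.+ b) ℤ.+ (c ℤ.+ d)) ℤ.- (y ℤ.+ y)
    regroup = ℤ-solve-∀
    values : ∀ a b c d e → (a ℤ.+ b ℤ.- half e k) ℤ.+ (c ℤ.+ d ℤ.- half e k) ≡
                           ((a ℤ.+ b) ℤ.+ (c ℤ.+ d)) ℤ.- full e (suc k)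
    values a b c d e = trans (regroup a b c d (half e k)) (cong (λ i → ((a ℤ.+ b) ℤ.+ (c ℤ.+ d)) ℤ.- i) (sym (full-suc e k)))

  isoperimetry : ∀ k i β → Rep (2 * Σₑ k i β cut + 2) (+ Σₑ k i β inner)
  isoperimetry k i β = subst (Rep _) (cancel (+ Σₑ k i β inner) (full (x β i) k)) (rep-+ (iso k i β) (rep-full (x β i) k))
    where
    cancel : ∀ a b → a ℤ.- b ℤ.+ b ≡ a
    cancel = ℤ-solve-∀

-- Counting the members of a subset along the heap

-- Heap nodes are numbered from 1; the index 0 is never a member.
nth at : ∀ {n} → Subset n → ℕ → Bool
nth []      _       = false
nth (b ∷ S) zero    = b
nth (b ∷ S) (suc i) = nth S i
at S zero    = false
at S (suc i) = nth S i

node : ∀ {n} → Fin n → ℕ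
node v = suc (toℕ v)

∈⇒at : ∀ {n} {v} {S : Subset n} → v ∈ S → at S (node v) ≡ true
∈⇒at here       = refl
∈⇒at (there v∈) = ∈⇒at v∈

at⇒∈ : ∀ {n} {v} (S : Subset n) → at S (node v) ≡ true → v ∈ S
at⇒∈ {v = zero}  (true ∷ S) refl = here
at⇒∈ {v = suc v} (_    ∷ S) eq   = there (at⇒∈ S eq)

Σ< : ℕ → (ℕ → ℕ) → ℕ
Σ< zero    f = 0
Σ< (suc m) f = f 0 + Σ< m (f ∘ suc)

Σ<-cong : ∀ m {f g : ℕ → ℕ} → (∀ i → f i ≡ g i) → Σ< m f ≡ Σ< m g
Σ<-cong zero    eq = refl
Σ<-cong (suc m) eq = cong₂ _+_ (eq 0) (Σ<-cong m (eq ∘ suc))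

Σ<-pairs : ∀ m f → Σ< (m + m) f ≡ Σ< m (λ i → f (i + i) + f (suc (i + i)))
Σ<-pairs zero    f = refl
Σ<-pairs (suc m) f rewrite ℕ.+-suc m m = begin
  f 0 + (f 1 + Σ< (m + m) f′)
    ≡⟨ sym (ℕ.+-assoc (f 0) (f 1) _) ⟩
  f 0 + f 1 + Σ< (m + m) f′
    ≡⟨ cong (λ s → f 0 + f 1 + s) (Σ<-pairs m f′) ⟩
  f 0 + f 1 + Σ< m (λ i → f (2 + (i + i)) + f (3 + (i + i)))
    ≡⟨ cong (λ s → f 0 + f 1 + s) (Σ<-cong m λ i → cong (λ j → f (suc j) + f (2 + j)) (sym (ℕ.+-suc i i))) ⟩
  f 0 + f 1 + Σ< m (λ i → f (suc i + suc i) + f (suc (suc i + suc i))) ∎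
  where
  open ≡-Reasoning
  f′ : ℕ → ℕ
  f′ i = f (2 + i)

Σ<-nth : ∀ {n} m (S : Subset n) → Σ< m (𝟙 ∘ nth S) ≤ ∣ S ∣
Σ<-nth zero    S           = z≤n
Σ<-nth (suc m) []          = Σ<-nth m []
Σ<-nth (suc m) (true  ∷ S) = s≤s (Σ<-nth m S)
Σ<-nth (suc m) (false ∷ S) = Σ<-nth m S

-- Each node except the root is a child of exactly one node of the tree with the lowest level
-- removed.
Σᵥ-pairs : ∀ k i f → Σᵥ (suc k) i f ≡ f i + Σᵥ k i (λ j → f (j + j) + f (suc (j + j)))
Σᵥ-pairs zero    i f = refl
Σᵥ-pairs (suc k) i f = cong (λ s → f i + s) (begin
  Σᵥ (suc k) (i + i) f + Σᵥ (suc k) (suc (i + i)) f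
    ≡⟨ cong₂ _+_ (Σᵥ-pairs k (i + i) f) (Σᵥ-pairs k (suc (i + i)) f) ⟩
  (f (i + i) + Σᵥ k (i + i) _) + (f (suc (i + i)) + Σᵥ k (suc (i + i)) _)
    ≡⟨ regroup (f (i + i)) _ (f (suc (i + i))) _ ⟩
  f (i + i) + f (suc (i + i)) + (Σᵥ k (i + i) _ + Σᵥ k (suc (i + i)) _) ∎)
  where
  open ≡-Reasoning
  regroup : ∀ a b c d → (a + b) + (c + d) ≡ a + c + (b + d)
  regroup = solve-∀

-- Heap order numbers the tree below 1 without gaps. The index 0 completes the range to a power of
-- two and is its own even child, so pairing halves the range.
Σᵥ-root : ∀ k f → f 0 + Σᵥ k 1 f ≡ Σ< (2 ^ suc k) f
Σᵥ-root zero    f = cong (λ s → f 0 + s) (sym (ℕ.+-identityʳ (f 1)))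
Σᵥ-root (suc k) f = begin
  f 0 + Σᵥ (suc k) 1 f                  ≡⟨ cong (λ s → f 0 + s) (Σᵥ-pairs k 1 f) ⟩
  f 0 + (f 1 + Σᵥ k 1 f₂)               ≡⟨ sym (ℕ.+-assoc (f 0) (f 1) _) ⟩
  f₂ 0 + Σᵥ k 1 f₂                      ≡⟨ Σᵥ-root k f₂ ⟩
  Σ< (2 ^ suc k) f₂                     ≡⟨ sym (Σ<-pairs (2 ^ suc k) f) ⟩
  Σ< (2 ^ suc k + 2 ^ suc k) f          ≡⟨ cong (λ m → Σ< (2 ^ suc k + m) f) (sym (ℕ.+-identityʳ (2 ^ suc k))) ⟩
  Σ< (2 ^ suc (suc k)) f                ∎
  where
  open ≡-Reasoning
  f₂ : ℕ → ℕ
  f₂ j = f (j + j) + f (suc (j + j))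

Σᵥ-at : ∀ {n} k (S : Subset n) → Σᵥ k 1 (𝟙 ∘ at S) ≤ ∣ S ∣
Σᵥ-at k S with 2 ^ suc k | Σᵥ-root k (𝟙 ∘ at S)
... | zero  | eq = ℕ.≤-trans (ℕ.≤-reflexive eq) z≤n
... | suc m | eq = ℕ.≤-trans (ℕ.≤-reflexive eq) (Σ<-nth m S)

-- Every node lies on at most three edges, the root i on at most two.
Σₑ-ends : ∀ (f : ℕ → ℕ) k i β → Σₑ k i β (λ _ p q → f p + f q) + f i ≤ 3 * Σᵥ k i f
Σₑ-ends f zero    i β = ℕ.m≤n*m (f i) 3
Σₑ-ends f (suc k) i β = begin
  (f i + f l + L) + (f i + f r + R) + f i   ≡⟨ regroup (f i) (f l) L (f r) R ⟩
  3 * f i + ((L + f l) + (R + f r))         ≤⟨ ℕ.+-monoʳ-≤ (3 * f i) (ℕ.+-mono-≤ (Σₑ-ends f k l (not β)) (Σₑ-ends f k r (not β))) ⟩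
  3 * f i + (3 * Σᵥ k l f + 3 * Σᵥ k r f)   ≡⟨ regroup′ (f i) (Σᵥ k l f) (Σᵥ k r f) ⟩
  3 * Σᵥ (suc k) i f                        ∎
  where
  open ℕ.≤-Reasoning
  l = i + i
  r = suc (i + i)
  L = Σₑ k l (not β) (λ _ p q → f p + f q)
  R = Σₑ k r (not β) (λ _ p q → f p + f q)
  regroup : ∀ a b L c R → (a + b + L) + (a + c + R) + a ≡ 3 * a + ((L + b) + (R + c))
  regroup = solve-∀
  regroup′ : ∀ a l r → 3 * a + (3 * l + 3 * r) ≡ 3 * (a + (l + r))
  regroup′ = solve-∀

-- The heap-ordered binary tree

-- The order n is arbitrary, so the last level may be incomplete. As `node` starts at 1, the parent
-- 0 of the root is not a vertex.
heap : ∀ n → Graph n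
heap n = record
  { _~_      = λ u v → IsParent (node u) (node v) ⊎ IsParent (node v) (node u)
  ; _~?_     = λ u v → (_ ℕ.≟ _) ⊎-dec (_ ℕ.≟ _)
  ; ~-sym    = [ inj₂ , inj₁ ]′
  ; ~-irrefl = λ {v} → [ no-loop v , no-loop v ]′
  }
  where
  no-loop : ∀ (v : Fin n) → ¬ IsParent (node v) (node v)
  no-loop v = ℕ.<⇒≢ (ℕ.⌊n/2⌋<n (toℕ v))

heap-connected : ∀ n → Connected (heap n)
heap-connected (suc m) u v = to-root m u (Fin.toℕ≤pred[n] u) ◅◅
                             Star.reverse (Graph.~-sym (heap (suc m))) (to-root m v (Fin.toℕ≤pred[n] v))
  where
  to-root : ∀ b (u : Fin (suc m)) → toℕ u ≤ b → Star (Graph._~_ (heap (suc m))) u zero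
  to-root b       zero    _  = ε
  to-root (suc b) (suc u) (s≤s u≤b) = inj₂ parent ◅ to-root b p p≤b
    where
    p<n : ⌊ toℕ u /2⌋ < suc m
    p<n = s≤s (ℕ.≤-trans (ℕ.⌊n/2⌋≤n (toℕ u)) (ℕ.<⇒≤ (Fin.toℕ<n u)))
    p = Fin.fromℕ< p<n
    parent : IsParent (node p) (node (suc u))
    parent = cong suc (sym (Fin.toℕ-fromℕ< p<n))
    p≤b : toℕ p ≤ b
    p≤b = ℕ.≤-trans (ℕ.≤-reflexive (Fin.toℕ-fromℕ< p<n)) (ℕ.≤-trans (ℕ.⌊n/2⌋≤n (toℕ u)) u≤b)

argmax : ∀ {m} (f : Fin (suc m) → ℕ) → ∃[ i ] (∀ j → f j ≤ f i)
argmax {zero}  f = zero , λ { zero → ℕ.≤-refl }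
argmax {suc m} f with argmax (f ∘ suc)
... | i , max with ℕ.≤-total (f zero) (f (suc i))
...   | inj₁ le = suc i , λ { zero → le ; (suc j) → max j }
...   | inj₂ ge = zero , λ { zero → ℕ.≤-refl ; (suc j) → ℕ.≤-trans (max j) ge }

cycle-neighbours : ∀ {n} {G : Graph n} (c : Cycle G) → let open Cycle c in let open Graph G in
                   ∀ i → ∃[ j₁ ] ∃[ j₂ ] j₁ ≢ j₂ × vertex j₁ ~ vertex i × vertex j₂ ~ vertex i
cycle-neighbours {G = G} c zero = suc zero , fromℕ (2 + k) , (λ ()) , ~-sym (isWalk zero (suc zero) refl) , closes
  where open Cycle c; open Graph G
cycle-neighbours {G = G} c (suc i) with toℕ i ℕ.<? 1 + Cycle.k c
... | yes i<last = inject₁ i , next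
      , (λ eq → ℕ.m≢1+n+m (toℕ i) (trans (trans (sym (Fin.toℕ-inject₁ i)) (cong toℕ eq)) next≡))
      , isWalk _ _ (cong suc (sym (Fin.toℕ-inject₁ i)))
      , ~-sym (isWalk (suc i) next next≡)
  where
  open Cycle c; open Graph G
  next : Fin (3 + k)
  next = Fin.fromℕ< (s≤s (s≤s i<last))
  next≡ : toℕ next ≡ 2 + toℕ i
  next≡ = Fin.toℕ-fromℕ< (s≤s (s≤s i<last))
... | no i≮last = inject₁ i , zero
      , (λ eq → i≮last (subst (_< 1 + k) (trans (sym (cong toℕ eq)) (Fin.toℕ-inject₁ i)) (s≤s z≤n)))
      , isWalk _ _ (cong suc (sym (Fin.toℕ-inject₁ i)))
      , subst (λ j → vertex zero ~ vertex j) last≡ (~-sym closes)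
  where
  open Cycle c; open Graph G
  last≡ : fromℕ (2 + k) ≡ suc i
  last≡ = Fin.toℕ-injective (trans (Fin.toℕ-fromℕ (2 + k))
    (cong suc (ℕ.≤-antisym (ℕ.≮⇒≥ i≮last) (Fin.toℕ≤pred[n] i))))

-- The largest vertex of a cycle would have two distinct parents.
heap-acyclic : ∀ n → ¬ Cycle (heap n)
heap-acyclic n c =
  let open Cycle c
      i , max = argmax (toℕ ∘ vertex)
      j₁ , j₂ , j₁≢j₂ , e₁ , e₂ = cycle-neighbours c i
      below : ∀ j → Graph._~_ (heap n) (vertex j) (vertex i) → IsParent (node (vertex j)) (node (vertex i))
      below j = [ id , (λ par → contradiction (max j) (ℕ.<⇒≱ (ℕ.≤-pred
                  (ℕ.≤-trans (s≤s (ℕ.≤-reflexive (sym par))) (ℕ.⌊n/2⌋<n (toℕ (vertex j))))))) ]′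
  in j₁≢j₂ (injective (Fin.toℕ-injective (ℕ.suc-injective (trans (sym (below j₁ e₁)) (below j₂ e₂)))))

heap-isTree : ∀ n → n ≥ 1 → IsTree (heap n)
heap-isTree n n≥1 = record
  { nonEmpty = >-nonZero n≥1 ; connected = heap-connected n ; acyclic = heap-acyclic n }

-- The mouse evades few cats on the heap

-- The end of colour `c` of an edge whose parent end `p` has colour `β` and whose child end `q` has
-- the opposite colour.
pick : {A : Set} → Bool → Bool → A → A → A
pick c β p q = if β xor c then q else p

node-of : ∀ {n x} → 1 ≤ x → x ≤ n → Σ[ v ∈ Fin n ] node v ≡ x
node-of (s≤s {n = x} _) x<n = Fin.fromℕ< x<n , cong suc (Fin.toℕ-fromℕ< x<n)

𝟙-∧ˡ : ∀ {a b} → (a ≡ true → b ≡ true) → 𝟙 (a ∧ b) ≡ 𝟙 a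
𝟙-∧ˡ {false} a⇒b = refl
𝟙-∧ˡ {true}  a⇒b = cong 𝟙 (a⇒b refl)

𝟙-∧ʳ : ∀ {a b} → (a ≡ true → b ≡ true) → 𝟙 (b ∧ a) ≡ 𝟙 a
𝟙-∧ʳ {a} {b} a⇒b = trans (cong 𝟙 (Bool.∧-comm b a)) (𝟙-∧ˡ a⇒b)

𝟙-xorˡ : ∀ {a b} → (a ≡ true → b ≡ true) → 𝟙 b ≡ 𝟙 a + 𝟙 (a xor b)
𝟙-xorˡ {false} a⇒b = refl
𝟙-xorˡ {true}  a⇒b rewrite a⇒b refl = refl

𝟙-xorʳ : ∀ {a b} → (a ≡ true → b ≡ true) → 𝟙 b ≡ 𝟙 a + 𝟙 (b xor a)
𝟙-xorʳ {a} {b} a⇒b = trans (𝟙-xorˡ a⇒b) (cong (λ x → 𝟙 a + 𝟙 x) (Bool.xor-comm a b))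

-- By `fits`, the heap contains the perfect tree of height K, with 2^(K+1) - 1 nodes. The potential
-- counts edges of that tree only.
module _ (n K : ℕ) (fits : 2 * 2 ^ K ≤ suc n) where
  open Game (heap n)

  -- The number of edges whose end of colour c lies in s.
  Φ : Bool → (ℕ → Bool) → ℕ
  Φ c s = Σₑ K 1 true (λ β p q → 𝟙 (s (pick c β p q)))

  module _ (S C : Subset n) where

    survivors reached : ℕ → Bool
    survivors v = at S v ∧ not (at C v)
    reached     = at (step S C)

    reach : ∀ u v → Graph._~_ (heap n) u v → survivors (node u) ≡ true → reached (node v) ≡ true
    reach u v u~v s with at S (node u) in inS | at C (node u) in inC | s
    ... | true | false | _ = ∈⇒at (∈-comprehension⁺ (next? S C)
      (u , at⇒∈ S inS , (λ u∈C → case trans (sym inC) (∈⇒at u∈C) of λ ()) , u~v))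

    reach-edge : ∀ {p q} → 1 ≤ p → IsParent p q → q ≤ n →
                 (survivors p ≡ true → reached q ≡ true) × (survivors q ≡ true → reached p ≡ true)
    reach-edge {q = zero}  () refl _
    reach-edge {q = suc q} 1≤p refl q≤n
      with node-of 1≤p (ℕ.≤-trans (ℕ.⌊n/2⌋≤n (suc q)) q≤n) | node-of (s≤s z≤n) q≤n
    ... | u , u≡ | v , refl rewrite sym u≡ = reach u v (inj₁ (sym u≡)) , reach v u (inj₂ (sym u≡))

    -- The mouse may be at the c-end of an edge before its move, and at the
    -- other end after it.
    front : Bool → Bool → ℕ → Bool
    front c β v = pick c β (survivors v) (reached v)

    -- A mouse surviving at the `c`-end can move across the edge, so the other end is then in
    -- `front` as well.
    front-inner : ∀ c β p q → 1 ≤ p → IsParent p q → q ≤ n →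
                  inner (front c) β p q ≡ 𝟙 (survivors (pick c β p q))
    front-inner false false p q 1≤p par q≤n = 𝟙-∧ˡ (proj₁ (reach-edge 1≤p par q≤n))
    front-inner false true  p q 1≤p par q≤n = 𝟙-∧ʳ (proj₂ (reach-edge 1≤p par q≤n))
    front-inner true  false p q 1≤p par q≤n = 𝟙-∧ʳ (proj₂ (reach-edge 1≤p par q≤n))
    front-inner true  true  p q 1≤p par q≤n = 𝟙-∧ˡ (proj₁ (reach-edge 1≤p par q≤n))

    -- For the same reason an edge is cut only when its other end is reached although no mouse
    -- survives at the `c`-end.
    front-cut : ∀ c β p q → 1 ≤ p → IsParent p q → q ≤ n →
                𝟙 (reached (pick (not c) β p q)) ≡ 𝟙 (survivors (pick c β p q)) + cut (front c) β p q
    front-cut false false p q 1≤p par q≤n = 𝟙-xorˡ (proj₁ (reach-edge 1≤p par q≤n))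
    front-cut false true  p q 1≤p par q≤n = 𝟙-xorʳ (proj₂ (reach-edge 1≤p par q≤n))
    front-cut true  false p q 1≤p par q≤n = 𝟙-xorʳ (proj₂ (reach-edge 1≤p par q≤n))
    front-cut true  true  p q 1≤p par q≤n = 𝟙-xorˡ (proj₁ (reach-edge 1≤p par q≤n))

    boundary : Bool → ℕ
    boundary c = Σₑ K 1 true (cut (front c))

    Φ-survivors-rep : ∀ c → Rep (2 * boundary c + 2) (+ Φ c survivors)
    Φ-survivors-rep c = subst (λ m → Rep (2 * boundary c + 2) (+ m))
      (Σₑ-cong n (front-inner c) K 1 true (s≤s z≤n) fits) (isoperimetry (front c) K 1 true)

    Φ-reached : ∀ c → Φ (not c) reached ≡ Φ c survivors + boundary c
    Φ-reached c = trans (Σₑ-cong n (front-cut c) K 1 true (s≤s z≤n) fits)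
                        (Σₑ-+ (λ β p q → 𝟙 (survivors (pick c β p q))) (cut (front c)) K 1 true)

    Φ-survivors : ∀ c → Φ c (at S) ≤ Φ c survivors + 3 * ∣ C ∣
    Φ-survivors c = begin
      Φ c (at S)
        ≤⟨ Σₑ-mono (λ β p q → lost β p q) K 1 true ⟩
      Σₑ K 1 true (λ β p q → 𝟙 (survivors (pick c β p q)) + ends β p q)
        ≡⟨ Σₑ-+ (λ β p q → 𝟙 (survivors (pick c β p q))) ends K 1 true ⟩
      Φ c survivors + Σₑ K 1 true ends
        ≤⟨ ℕ.+-monoʳ-≤ (Φ c survivors) (ℕ.≤-trans (ℕ.m≤m+n _ _) (Σₑ-ends (𝟙 ∘ at C) K 1 true)) ⟩
      Φ c survivors + 3 * Σᵥ K 1 (𝟙 ∘ at C)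
        ≤⟨ ℕ.+-monoʳ-≤ (Φ c survivors) (ℕ.*-monoʳ-≤ 3 (Σᵥ-at K C)) ⟩
      Φ c survivors + 3 * ∣ C ∣ ∎
      where
      open ℕ.≤-Reasoning
      ends : Bool → ℕ → ℕ → ℕ
      ends _ p q = 𝟙 (at C p) + 𝟙 (at C q)
      split : ∀ s t → 𝟙 s ≤ 𝟙 (s ∧ not t) + 𝟙 t
      split false t     = z≤n
      split true  false = ℕ.≤-refl
      split true  true  = ℕ.≤-refl
      lost : ∀ β p q → 𝟙 (at S (pick c β p q)) ≤ 𝟙 (survivors (pick c β p q)) + ends β p q
      lost β p q = ℕ.≤-trans (split (at S (pick c β p q)) (at C (pick c β p q)))
                             (ℕ.+-monoʳ-≤ (𝟙 (survivors (pick c β p q))) (one-end (β xor c)))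
        where
        one-end : ∀ b → 𝟙 (at C (if b then q else p)) ≤ ends β p q
        one-end false = ℕ.m≤m+n _ _
        one-end true  = ℕ.m≤n+m _ _

  Φ-⊤ : ∀ c → 2 + Φ c (at ⊤) ≡ 2 ^ suc K
  Φ-⊤ c = trans (cong (λ s → 2 + s) (Σₑ-cong n all K 1 true (s≤s z≤n) fits)) (Σₑ-1 K 1 true)
    where
    at-⊤ : ∀ {x} → 1 ≤ x → x ≤ n → at (⊤ {n}) x ≡ true
    at-⊤ 1≤x x≤n with node-of 1≤x x≤n
    ... | v , refl = ∈⇒at (∈⊤ {x = v})
    all : ∀ β p q → 1 ≤ p → IsParent p q → q ≤ n → 𝟙 (at (⊤ {n}) (pick c β p q)) ≡ 1
    all β p q 1≤p par q≤n with β xor c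
    ... | false = cong 𝟙 (at-⊤ 1≤p (ℕ.≤-trans (ℕ.≤-reflexive (sym par)) (ℕ.≤-trans (ℕ.⌊n/2⌋≤n q) q≤n)))
    ... | true  = cong 𝟙 (at-⊤ (ℕ.≤-trans (ℕ.≤-trans 1≤p (ℕ.≤-reflexive (sym par))) (ℕ.⌊n/2⌋≤n q)) q≤n)

  Φ-⊥ : ∀ c → Φ c (at ⊥) ≡ 0
  Φ-⊥ c = go K 1 true
    where
    nth-⊥ : ∀ m i → nth (⊥ {m}) i ≡ false
    nth-⊥ zero    i       = refl
    nth-⊥ (suc m) zero    = refl
    nth-⊥ (suc m) (suc i) = nth-⊥ m i
    at-⊥ : ∀ x → at (⊥ {n}) x ≡ false
    at-⊥ zero    = refl
    at-⊥ (suc x) = nth-⊥ n x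
    go : ∀ k i β → Σₑ k i β (λ β p q → 𝟙 (at (⊥ {n}) (pick c β p q))) ≡ 0
    go zero    i β = refl
    go (suc k) i β rewrite go k (i + i) (not β) | go k (suc (i + i)) (not β)
                         | at-⊥ (pick c β i (i + i)) | at-⊥ (pick c β i (suc (i + i))) = refl

  -- If T has no light signed binary representation, the potential cannot
  -- cross the window from T to T + 3 r: inside it, the boundary is too large.
  module _ (r T : ℕ) (heavy : ∀ {w} → Rep w (+ T) → 9 * r + 3 ≤ w) where

    window : ∀ {a b} → T ≤ a → Rep (2 * b + 2) (+ a) → T + 3 * r ≤ a + b
    window {a} {b} T≤a rep-a with b ℕ.<? 3 * r | a ℕ.<? T + 3 * r
    ... | no b≮  | _      = ℕ.+-mono-≤ T≤a (ℕ.≮⇒≥ b≮)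
    ... | yes _  | no a≮  = ℕ.≤-trans (ℕ.≮⇒≥ a≮) (ℕ.m≤m+n a b)
    -- Here `T` lies less than 3 r below `a`. Subtracting the difference as a single digit gives `T`
    -- a weight below (6 r + 2) + 3 r, too little for `heavy`.
    ... | yes b< | yes a< = contradiction (heavy rep-T) (ℕ.<⇒≱ (begin-strict
      2 * b + 2 + (a ∸ T)       <⟨ ℕ.+-monoʳ-< (2 * b + 2) δ< ⟩
      2 * b + 2 + 3 * r         ≤⟨ ℕ.+-monoˡ-≤ (3 * r) (ℕ.+-monoˡ-≤ 2 (ℕ.*-monoʳ-≤ 2 (ℕ.<⇒≤ b<))) ⟩
      2 * (3 * r) + 2 + 3 * r   ≡⟨ collect r ⟩
      9 * r + 2                 ≤⟨ ℕ.+-monoʳ-≤ (9 * r) (s≤s (s≤s (z≤n {1}))) ⟩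
      9 * r + 3                 ∎))
      where
      open ℕ.≤-Reasoning
      collect : ∀ r → 2 * (3 * r) + 2 + 3 * r ≡ 9 * r + 2
      collect = solve-∀
      δ< : a ∸ T < 3 * r
      δ< = ℕ.+-cancelˡ-< T (a ∸ T) (3 * r) (subst (_< T + 3 * r) (sym (ℕ.m+[n∸m]≡n T≤a)) a<)
      rep-T : Rep (2 * b + 2 + (a ∸ T)) (+ T)
      rep-T = subst₂ Rep (cong (λ s → 2 * b + 2 + s) (ℤ.∣-i∣≡∣i∣ (+ (a ∸ T))))
                (trans (cong (λ m → + m ℤ.- + (a ∸ T)) (sym (ℕ.m+[n∸m]≡n T≤a))) (cancel (+ T) (+ (a ∸ T))))
                (rep-+ rep-a (rep-digit (ℤ.- + (a ∸ T))))
        where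
        cancel : ∀ t d → (t ℤ.+ d) ℤ.- d ≡ t
        cancel = ℤ-solve-∀

    -- The cats take away at most 3 r, which leaves at least `T`; by `window` the move of the mouse
    -- brings the potential back to `T + 3 * r`, now for the other colour.
    Φ-step : ∀ c S C → ∣ C ∣ ≤ r → T + 3 * r ≤ Φ c (at S) → T + 3 * r ≤ Φ (not c) (at (step S C))
    Φ-step c S C small large = ℕ.≤-trans (window T≤ (Φ-survivors-rep S C c)) (ℕ.≤-reflexive (sym (Φ-reached S C c)))
      where
      T≤ : T ≤ Φ c (survivors S C)
      T≤ = ℕ.+-cancelʳ-≤ (3 * r) T _ (ℕ.≤-trans large
             (ℕ.≤-trans (Φ-survivors S C c) (ℕ.+-monoʳ-≤ (Φ c (survivors S C)) (ℕ.*-monoʳ-≤ 3 small))))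

    Φ-after : ∀ Cs → All (λ C → ∣ C ∣ ≤ r) Cs → ∀ c S → T + 3 * r ≤ Φ c (at S) →
              ∃[ c′ ] T + 3 * r ≤ Φ c′ (at (after S Cs))
    Φ-after []       []       c S large = c , large
    Φ-after (C ∷ Cs) (p ∷ ps) c S large = Φ-after Cs ps (not c) (step S C) (Φ-step c S C p large)

    -- Initially the potential is 2^(K+1) - 2, hence the condition `room`; it would have to drop to
    -- 0 < `T` for the cats to win.
    heap-mouseWin : 1 ≤ T → T + 3 * r + 2 ≤ 2 ^ suc K → ¬ CatWin (heap n) r
    heap-mouseWin 1≤T room win =
      let Cs , small , wins = catWin⇒beats win
          c , large = Φ-after Cs small true ⊤ start
          empty = Empty-unique λ (w , w∈) → let u , _ , e = after⁻ Cs w∈ in wins u w e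
      in ℕ.<⇒≱ 1≤T (ℕ.≤-trans (ℕ.m≤m+n T (3 * r))
           (ℕ.≤-trans large (ℕ.≤-reflexive (trans (cong (Φ c ∘ at) empty) (Φ-⊥ c)))))
      where
      start : T + 3 * r ≤ Φ true (at ⊤)
      start = ℕ.+-cancelʳ-≤ 2 _ _ (ℕ.≤-trans room (ℕ.≤-reflexive (trans (sym (Φ-⊤ true)) (ℕ.+-comm 2 _))))

-- Choice of parameters and comparison with the logarithm

3*alternating : ∀ K → 3 * alternating K + 1 ≡ 4 ^ K
3*alternating zero    = refl
3*alternating (suc K) = trans (shift (alternating K)) (cong (4 *_) (3*alternating K))
  where
  shift : ∀ a → 3 * (1 + 4 * a) + 1 ≡ 4 * (3 * a + 1)
  shift = solve-∀

m≤alternating : ∀ K → K ≤ alternating K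
m≤alternating zero    = z≤n
m≤alternating (suc K) = s≤s (ℕ.≤-trans (m≤alternating K) (ℕ.m≤n*m (alternating K) 4))

heap-catWin⇒≥ : ∀ n K r → 4 ^ K ≤ suc n → CatWin (heap n) r → K < 9 * r + 3
heap-catWin⇒≥ n zero    r fits win = ℕ.≤-trans (s≤s z≤n) (ℕ.m≤n+m 3 (9 * r))
-- Height 2 K + 1 gives a perfect tree with 4^(K+1) - 1 nodes, and the threshold has K + 1 binary
-- ones.
heap-catWin⇒≥ n (suc K) r fits win = ℕ.≰⇒> λ heavy → heap-mouseWin n (suc (2 * K)) fits′ r T
  (λ rp → ℕ.≤-trans heavy (rep-alternating (suc K) rp)) (s≤s z≤n) (room heavy) win
  where
  T = alternating (suc K)
  4^ : 4 ^ suc K ≡ 2 ^ (2 + 2 * K)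
  4^ = trans (ℕ.^-*-assoc 2 2 (suc K)) (cong (2 ^_) (ℕ.*-suc 2 K))
  fits′ : 2 ^ (2 + 2 * K) ≤ suc n
  fits′ = ℕ.≤-trans (ℕ.≤-reflexive (sym 4^)) fits
  open ℕ.≤-Reasoning
  -- The threshold is about a third of 4^(K+1), and 3 r + 2 is at most the threshold.
  room : 9 * r + 3 ≤ suc K → T + 3 * r + 2 ≤ 2 ^ (2 + 2 * K)
  room heavy = begin
    T + 3 * r + 2          ≡⟨ ℕ.+-assoc T (3 * r) 2 ⟩
    T + (3 * r + 2)        ≤⟨ ℕ.+-monoʳ-≤ T (ℕ.+-mono-≤ (ℕ.*-monoˡ-≤ r (s≤s (s≤s (s≤s (z≤n {6}))))) (s≤s (s≤s (z≤n {1})))) ⟩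
    T + (9 * r + 3)        ≤⟨ ℕ.+-monoʳ-≤ T (ℕ.≤-trans heavy (m≤alternating (suc K))) ⟩
    T + T                  ≤⟨ ℕ.≤-trans (ℕ.m≤n+m (T + T) (suc T)) (ℕ.≤-reflexive (collect T)) ⟩
    3 * T + 1              ≡⟨ 3*alternating (suc K) ⟩
    4 ^ suc K              ≡⟨ 4^ ⟩
    2 ^ (2 + 2 * K)        ∎
    where
    collect : ∀ t → suc t + (t + t) ≡ 3 * t + 1
    collect = solve-∀

n<4^n : ∀ n → n < 4 ^ n
n<4^n zero    = s≤s z≤n
n<4^n (suc n) = begin-strict
  suc n               ≤⟨ n<4^n n ⟩
  4 ^ n               <⟨ ℕ.m<m+n (4 ^ n) (ℕ.≤-trans (ℕ.m^n>0 4 n) (ℕ.m≤n*m (4 ^ n) 3)) ⟩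
  4 ^ n + 3 * 4 ^ n   ∎
  where open ℕ.≤-Reasoning

-- The witness is the largest K with 4^K ≤ n + 1; by maximality n < 4^(K+1) = 2^(2 (K+1)).
⌊log₂⌋≤2⌊log₄⌋ : ∀ n → ∃[ K ] 4 ^ K ≤ suc n × ⌊log₂ n ⌋ ≤ 2 * suc K
⌊log₂⌋≤2⌊log₄⌋ n =
  let K , fits , max = greatest (λ K → 4 ^ K ℕ.≤? suc n) n
        (λ k fits → ℕ.≤-pred (ℕ.≤-trans (n<4^n k) fits)) (0 , s≤s z≤n)
      n≤ = ℕ.≤-trans (ℕ.n≤1+n n) (ℕ.<⇒≤ (ℕ.≰⇒> λ fits′ → ℕ.1+n≰n (max (suc K) fits′)))
  in K , fits , ℕ.≤-trans (⌊log₂⌋-mono-≤ (ℕ.≤-trans n≤ (ℕ.≤-reflexive (ℕ.^-*-assoc 2 2 (suc K)))))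
                          (ℕ.≤-reflexive (⌊log₂[2^n]⌋≡n (2 * suc K)))

log≤h-heap : ∀ {n r} → CatWin (heap n) r → ⌊log₂ n ⌋ ≤ 18 * r + 6
log≤h-heap {n} {r} win = let K , fits , log≤ = ⌊log₂⌋≤2⌊log₄⌋ n in begin
  ⌊log₂ n ⌋           ≤⟨ log≤ ⟩
  2 * suc K           ≤⟨ ℕ.*-monoʳ-≤ 2 (heap-catWin⇒≥ n K r fits win) ⟩
  2 * (9 * r + 3)     ≡⟨ expand r ⟩
  18 * r + 6          ∎
  where
  open ℕ.≤-Reasoning
  expand : ∀ r → 2 * (9 * r + 3) ≡ 18 * r + 6
  expand = solve-∀

-- The extremal function and its two bounds

maxH : ℕ → ℕ
-- A default value: there is no tree of order 0.
maxH zero    = 0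
maxH (suc m) = proj₁ (maxOverTrees (suc m) (heap (suc m) , heap-isTree (suc m) (s≤s z≤n)))

maxH-isMax : ∀ n → n ≥ 1 → IsMaxOverTrees n (maxH n)
maxH-isMax (suc m) _ = proj₂ (maxOverTrees (suc m) (heap (suc m) , heap-isTree (suc m) (s≤s z≤n)))

maxH≤ : ∀ n → n ≥ 1 → maxH n ≤ suc ⌊log₂ n ⌋
maxH≤ n n≥1 = let (T , isTree , h) , _ = maxH-isMax n n≥1 in h-tree≤ isTree h

log≤maxH : ∀ n → n ≥ 1 → ⌊log₂ n ⌋ ≤ 18 * maxH n + 6
log≤maxH n n≥1 = begin
  ⌊log₂ n ⌋         ≤⟨ log≤h-heap (proj₁ (proj₂ (catNumber (heap n)))) ⟩
  18 * r + 6        ≤⟨ ℕ.+-monoˡ-≤ 6 (ℕ.*-monoʳ-≤ 18 r≤) ⟩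
  18 * maxH n + 6   ∎
  where
  open ℕ.≤-Reasoning
  r = proj₁ (catNumber (heap n))
  r≤ : r ≤ maxH n
  r≤ = proj₂ (maxH-isMax n n≥1) r (heap n , heap-isTree n n≥1 , proj₂ (catNumber (heap n)))

7≤18x+6⇒18x+6≤24x : ∀ x → 7 ≤ 18 * x + 6 → 18 * x + 6 ≤ 24 * x
7≤18x+6⇒18x+6≤24x zero    7≤6 = contradiction 7≤6 (ℕ.<⇒≱ ℕ.≤-refl)
7≤18x+6⇒18x+6≤24x (suc x) _   = begin
  18 * suc x + 6       ≤⟨ ℕ.+-monoʳ-≤ (18 * suc x) (ℕ.m≤m*n 6 (suc x)) ⟩
  18 * suc x + 6 * suc x ≡⟨ sym (ℕ.*-distribʳ-+ (suc x) 18 6) ⟩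
  24 * suc x           ∎
  where open ℕ.≤-Reasoning

mainTheorem3 : Σ[ g ∈ (ℕ → ℕ) ] (∀ n → n ≥ 1 → IsMaxOverTrees n (g n)) × g ∈Θ ⌊log₂_⌋
-- From n ≥ 2^7 on, the logarithm is at least 7, so 18 x + 6 ≥ 7 forces x ≥ 1 and 18 x + 6 ≤ 24 x.
-- The constant 2 absorbs the summand 1 of the upper bound.
mainTheorem3 = maxH , maxH-isMax , 24 , 2 , 2 ^ 7 , s≤s z≤n , s≤s z≤n , bounds
  where
  bounds : ∀ n → n ≥ 2 ^ 7 → ⌊log₂ n ⌋ ≤ 24 * maxH n × maxH n ≤ 2 * ⌊log₂ n ⌋
  bounds n n≥2^7 =
    ℕ.≤-trans lower (7≤18x+6⇒18x+6≤24x (maxH n) (ℕ.≤-trans 7≤log lower)) ,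
    ℕ.≤-trans (maxH≤ n n≥1) (ℕ.≤-trans (ℕ.+-monoˡ-≤ ⌊log₂ n ⌋ (ℕ.≤-trans (s≤s z≤n) 7≤log))
                                       (ℕ.≤-reflexive (cong (λ m → ⌊log₂ n ⌋ + m) (sym (ℕ.+-identityʳ _)))))
    where
    n≥1 : n ≥ 1
    n≥1 = ℕ.≤-trans (s≤s z≤n) n≥2^7
    7≤log : 7 ≤ ⌊log₂ n ⌋
    7≤log = ℕ.≤-trans (ℕ.≤-reflexive (sym (⌊log₂[2^n]⌋≡n 7))) (⌊log₂⌋-mono-≤ n≥2^7)
    lower = log≤maxH n n≥1
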